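{- The number of maximal triangle-free graphs with vertex set $[n]=\{1,\dots,n\}$ is at most $2^{n^2/8+o(n^2)}$, where $o(n^2)$ denotes a function $g(n)$ with $g(n)/n^2\to 0$ as $n\to\infty$.
   Context: A graph is triangle-free if it contains no three pairwise adjacent vertices. A triangle-free graph $H$ on vertex set $[n]$ is maximal triangle-free if adding any edge of the complete graph on $[n]$ not already in $H$ creates a triangle. Graphs are counted as labeled graphs on the fixed vertex set $[n]$. -}

module Defs where

open import Level using (0ℓ)
open import Data.Bool.Base using (true; false)
open import Data.Fin.Base using (Fin)
open import Data.Fin.Properties using (_≟_; all?; any?)
open import Data.Fin.Subset as Subset using (Subset)
open import Data.Fin.Subset.Properties using (_∈?_)
open import Data.Integer.Base as ℤ using (+_; -[1+_])
open import Data.List.Base using (List; []; _∷_; [_]; cartesianProductWith; filter; length)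
open import Data.List.Membership.Propositional using (_∈_)
open import Data.List.Membership.Propositional.Properties
  using (∈-cartesianProductWith⁺; ∈-filter⁺; ∈-filter⁻)
open import Data.List.Relation.Unary.All using ([]; _∷_)
open import Data.List.Relation.Unary.Any using (here; there)
open import Data.List.Relation.Unary.AllPairs using ([]; _∷_)
open import Data.List.Relation.Unary.Unique.Propositional using (Unique)
import Data.List.Relation.Unary.Unique.Propositional.Properties as Unique
open import Data.Nat.Base using (ℕ; zero; suc; NonZero; _*_; _^_; _≤_)
open import Data.Nat.Properties using (m^n≢0)
open import Data.Product.Base using (_×_; _,_; ∃-syntax; proj₂)
open import Data.Rational.Base as ℚ using (ℚ; mkℚ; 0ℚ)
open import Data.Sum.Base using (_⊎_)
open import Data.Vec.Base using (Vec; []; _∷_; lookup)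
open import Data.Vec.Properties using (∷-injective)
open import Function.Bundles using (_⇔_; mk⇔)
open import Relation.Binary.Core using (Rel)
open import Relation.Binary.Definitions using (Symmetric; Irreflexive; Decidable)
open import Relation.Binary.PropositionalEquality using (_≡_; _≢_; refl)
open import Relation.Nullary.Decidable using (Dec; map′; ¬?; _×-dec_; _⊎-dec_; _→-dec_)
open import Relation.Nullary.Negation using (¬_)

private
  variable
    n : ℕ

-- Row i is the neighbourhood of i.  As these matrices are first-order data,
-- propositional equality of matrices is equality of labelled graphs.
AdjacencyMatrix : ℕ → Set
AdjacencyMatrix n = Vec (Subset n) n

Adj : AdjacencyMatrix n → Rel (Fin n) 0ℓ
Adj A i j = j Subset.∈ lookup A i

IsSimpleGraph : Rel (Fin n) 0ℓ → Set
IsSimpleGraph E = Symmetric E × Irreflexive _≡_ E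

-- For an irreflexive E the three vertices are automatically distinct.
HasTriangle : Rel (Fin n) 0ℓ → Set
HasTriangle E = ∃[ i ] ∃[ j ] ∃[ k ] (E i j × E j k × E i k)

TriangleFree : Rel (Fin n) 0ℓ → Set
TriangleFree E = ¬ HasTriangle E

addEdge : Rel (Fin n) 0ℓ → Fin n → Fin n → Rel (Fin n) 0ℓ
addEdge E u v i j = E i j ⊎ (i ≡ u × j ≡ v) ⊎ (i ≡ v × j ≡ u)

IsMaximalTriangleFree : Rel (Fin n) 0ℓ → Set
IsMaximalTriangleFree E =
  TriangleFree E × (∀ u v → u ≢ v → ¬ E u v → HasTriangle (addEdge E u v))

IsMaximalTriangleFreeGraph : AdjacencyMatrix n → Set
IsMaximalTriangleFreeGraph A = IsSimpleGraph (Adj A) × IsMaximalTriangleFree (Adj A)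

adj? : (A : AdjacencyMatrix n) → Decidable (Adj A)
adj? A i j = j ∈? lookup A i

isSimpleGraph? : {E : Rel (Fin n) 0ℓ} → Decidable E → Dec (IsSimpleGraph E)
isSimpleGraph? E? =
  map′ (λ f {i} {j} → f i j) (λ f i j → f {i} {j})
    (all? λ i → all? λ j → E? i j →-dec E? j i)
  ×-dec
  map′ (λ f {i} {j} → f i j) (λ f i j → f {i} {j})
    (all? λ i → all? λ j → (i ≟ j) →-dec ¬? (E? i j))

hasTriangle? : {E : Rel (Fin n) 0ℓ} → Decidable E → Dec (HasTriangle E)
hasTriangle? E? = any? λ i → any? λ j → any? λ k → E? i j ×-dec E? j k ×-dec E? i k

addEdge? : {E : Rel (Fin n) 0ℓ} → Decidable E → ∀ u v → Decidable (addEdge E u v)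
addEdge? E? u v i j =
  E? i j ⊎-dec ((i ≟ u) ×-dec (j ≟ v)) ⊎-dec ((i ≟ v) ×-dec (j ≟ u))

isMaximalTriangleFree? : {E : Rel (Fin n) 0ℓ} → Decidable E → Dec (IsMaximalTriangleFree E)
isMaximalTriangleFree? E? =
  ¬? (hasTriangle? E?)
  ×-dec
  (all? λ u → all? λ v → ¬? (u ≟ v) →-dec ¬? (E? u v) →-dec hasTriangle? (addEdge? E? u v))

isMaximalTriangleFreeGraph? : (A : AdjacencyMatrix n) → Dec (IsMaximalTriangleFreeGraph A)
isMaximalTriangleFreeGraph? A = isSimpleGraph? (adj? A) ×-dec isMaximalTriangleFree? (adj? A)

allVecs : {X : Set} → List X → ∀ k → List (Vec X k)
allVecs xs zero    = [ [] ]
allVecs xs (suc k) = cartesianProductWith _∷_ xs (allVecs xs k)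

allSubsets : ∀ n → List (Subset n)
allSubsets = allVecs (true ∷ false ∷ [])

allMatrices : ∀ n → List (AdjacencyMatrix n)
allMatrices n = allVecs (allSubsets n) n

maximalTriangleFreeGraphs : ∀ n → List (AdjacencyMatrix n)
maximalTriangleFreeGraphs n = filter isMaximalTriangleFreeGraph? (allMatrices n)

numMaximalTriangleFree : ℕ → ℕ
numMaximalTriangleFree n = length (maximalTriangleFreeGraphs n)

-- The list contains every maximal triangle-free graph exactly once, so its
-- length is the number of such graphs.

∈-allVecs : {X : Set} {xs : List X} → (∀ x → x ∈ xs) → ∀ {k} (v : Vec X k) → v ∈ allVecs xs k
∈-allVecs all∈ []      = here refl
∈-allVecs all∈ (x ∷ v) = ∈-cartesianProductWith⁺ _∷_ (all∈ x) (∈-allVecs all∈ v)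

allVecs-unique : {X : Set} {xs : List X} → Unique xs → ∀ k → Unique (allVecs xs k)
allVecs-unique xs! zero    = [] ∷ []
allVecs-unique xs! (suc k) =
  Unique.cartesianProductWith⁺ _∷_ ∷-injective xs! (allVecs-unique xs! k)

∈-allSubsets : (p : Subset n) → p ∈ allSubsets n
∈-allSubsets = ∈-allVecs λ { true → here refl ; false → there (here refl) }

allSubsets-unique : ∀ n → Unique (allSubsets n)
allSubsets-unique = allVecs-unique (((λ ()) ∷ []) ∷ [] ∷ [])

∈-maximalTriangleFreeGraphs :
  {A : AdjacencyMatrix n} → A ∈ maximalTriangleFreeGraphs n ⇔ IsMaximalTriangleFreeGraph A
∈-maximalTriangleFreeGraphs {n} {A} = mk⇔
  (λ A∈ → proj₂ (∈-filter⁻ isMaximalTriangleFreeGraph? {xs = allMatrices n} A∈))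
  (∈-filter⁺ isMaximalTriangleFreeGraph? (∈-allVecs ∈-allSubsets A))

maximalTriangleFreeGraphs-unique : ∀ n → Unique (maximalTriangleFreeGraphs n)
maximalTriangleFreeGraphs-unique n =
  Unique.filter⁺ isMaximalTriangleFreeGraph? (allVecs-unique (allSubsets-unique n) n)

-- x ≤2^ r means x ≤ 2 ^ r for a rational exponent r = p / q: raise both sides
-- to the power q, and clear 2 ^ p to the left-hand side when p is negative.
infix 4 _≤2^_
_≤2^_ : ℕ → ℚ → Set
x ≤2^ mkℚ (+ p)    q-1 _ = x ^ suc q-1 ≤ 2 ^ p
x ≤2^ mkℚ -[1+ p ] q-1 _ = x ^ suc q-1 * 2 ^ suc p ≤ 1

IsLittleO-n² : (ℕ → ℚ) → Set
IsLittleO-n² g =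
  ∀ (ε : ℚ) → 0ℚ ℚ.< ε →
  ∃[ N ] ∀ n .{{_ : NonZero n}} → N ≤ n →
    ℚ.∣ g n ℚ.* (ℚ._/_ (+ 1) (n ^ 2) {{m^n≢0 n 2}}) ∣ ℚ.< ε

{-# OPTIONS --safe #-}
module Submission where

-- To every maximal triangle-free graph H one attaches a triangle-free graph F from a family of 2 ^ O(n)
-- graphs that misses at most ε n² edges of H: the vertices are split into boundedly many classes, and F joins
-- the pairs of classes whose large subsets all span many edges of H.  Such a partition comes from a one-sided
-- regularity lemma whose potential is the area of the "dead" pairs of classes, those known to be sparse.
-- Given F and S = H ∖ F, for which there are 2 ^ o(n²) choices, the edges of F that do not complete a triangle
-- with two edges of S are the vertices of a link graph: two of them are joined when they form a triangle with
-- an edge of S.  The link graph is triangle-free, and H ∩ F is a maximal independent set of it.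
-- By Mantel's theorem the link graph has at most n² / 4 vertices, so by the Hujter–Tuza theorem at most
-- about 2 ^ (n² / 8) graphs H share the same F and S.

open import Defs
open import Level using (0ℓ)
open import Data.Bool.Base using (Bool; true; false; if_then_else_; _∧_; _∨_; not)
import Data.Bool.Properties as Bool
open import Data.Empty using (⊥)
open import Data.Fin.Base as Fin using (Fin; zero; suc; combine; remQuot; funToFin; finToFun)
import Data.Fin.Properties as Fin
open import Data.Fin.Subset as Subset using (Subset)
open import Data.Fin.Subset.Properties using (anySubset?)
open import Data.List.Base
  using (List; []; _∷_; _++_; map; filter; length; tabulate; allFin; cartesianProduct; cartesianProductWith)
open import Data.List.Membership.Propositional using (_∈_; _∉_; _─_)
open import Data.List.Membership.Propositional.Properties
  using (∈-++⁻; ∈-filter⁺; ∈-filter⁻; ∈-cartesianProduct⁺; ∈-cartesianProductWith⁺; ∈-allFin)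
open import Data.List.Properties using (length-++; length-map; length-filter; length-tabulate; filter-all; filter-++; map-++)
open import Data.List.Relation.Unary.All as All using (All; []; _∷_)
open import Data.List.Relation.Unary.AllPairs using ([]; _∷_)
open import Data.List.Relation.Unary.Any using (here; there)
open import Data.List.Relation.Unary.Unique.Propositional using (Unique)
import Data.List.Relation.Unary.Unique.Propositional.Properties as Unique
open import Data.Nat.Base
  using (ℕ; zero; suc; pred; _+_; _*_; _^_; _/_; _⊔_; _≤_; _<_; z≤n; s≤s; s≤s⁻¹; _≤′_; ≤′-refl; ≤′-step; NonZero; >-nonZero)
open import Data.Nat.DivMod using (m/n*n≤m; /-monoˡ-≤; m*n/n≡m)
import Data.Nat.ListAction as ListAction
open import Data.Nat.ListAction.Properties using (sum-++)
open import Data.Nat.Properties hiding (_≟_)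
open import Data.Nat.Tactic.RingSolver using (solve-∀)
open import Data.Product.Base using (Σ-syntax; ∃-syntax; _×_; _,_; proj₁; proj₂)
import Data.Product.Properties as Product
open import Data.Rational.Base as ℚ using (ℚ; mkℚ)
import Data.Rational.Properties as ℚ
open import Data.Rational.Unnormalised.Base as ℚᵘ using (ℚᵘ; mkℚᵘ; _≃_; *≡*)
import Data.Rational.Unnormalised.Properties as ℚᵘ
open import Data.Sum.Base using (_⊎_; inj₁; inj₂; [_,_]′)
open import Data.Vec.Base as Vec using (Vec; []; _∷_; lookup)
open import Data.Vec.Properties as Vec using (lookup∘tabulate; tabulate∘lookup; tabulate-cong; []=⇒lookup; lookup⇒[]=)
open import Function.Base using (_∘_; id; case_of_)
open import Function.Bundles using (_⇔_; mk⇔; Equivalence; Inverse)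
open import Relation.Binary.Core using (Rel)
open import Relation.Binary.Definitions using (Symmetric; Decidable; DecidableEquality; tri<; tri≈; tri>)
open import Relation.Binary.PropositionalEquality
open import Relation.Nullary.Decidable using (Dec; yes; no; does; ¬?; _×-dec_; _⊎-dec_; dec-true)
open import Relation.Nullary.Negation using (¬_; contradiction)
import Relation.Unary as U
open import Algebra.Properties.Semiring.Sum +-*-semiring
  using (sum; sum-cong-≗; ∑-distrib-+; ∑-comm; *-distribˡ-sum; *-distribʳ-sum)

-- Duplicate-free lists

-- Counting all subgraphs of a triangle-free F would only give the exponent n² / 4; maximality
-- supplies the missing factor of one half. If uv is an edge of F outside H, then u and v have a
-- common neighbour w in H. As F is triangle-free, uw and vw are not both in F, and edges uv for
-- which both lie in S are discarded in advance. So exactly one of the two lies in S, and the other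
-- is an edge of H ∩ F linked to uv. This needs F to be exactly triangle-free, not merely poor in
-- triangles. Regularising H itself provides that: a triangle of classes that are pairwise dense
-- between large subsets is refuted by the neighbourhood of a single vertex of H, so neither a
-- removal lemma nor upper bounds on densities enter. Estimates are stated over the naturals, with
-- fractions and roots multiplied out.

module _ {A : Set} where

  ∈-remove : ∀ {x y : A} {ys} (x∈ys : x ∈ ys) → y ≢ x → y ∈ ys → y ∈ ys ─ x∈ys
  ∈-remove (here refl) y≢x (here y≡x) = contradiction y≡x y≢x
  ∈-remove (here refl) y≢x (there y∈) = y∈
  ∈-remove (there x∈) y≢x (here y≡) = here y≡
  ∈-remove (there x∈) y≢x (there y∈) = there (∈-remove x∈ y≢x y∈)

  length-remove : ∀ {x : A} {ys} (x∈ys : x ∈ ys) → suc (length (ys ─ x∈ys)) ≡ length ys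
  length-remove (here _) = refl
  length-remove {ys = _ ∷ _ ∷ _} (there x∈) = cong suc (length-remove x∈)

  unique-⊆⇒length≤ : ∀ {xs ys : List A} → Unique xs → (∀ {x} → x ∈ xs → x ∈ ys) → length xs ≤ length ys
  unique-⊆⇒length≤ {[]} _ _ = z≤n
  unique-⊆⇒length≤ {x ∷ xs} (x∉ ∷ xs!) xs⊆ys =
    ≤-trans
      (s≤s (unique-⊆⇒length≤ xs! λ y∈ → ∈-remove x∈ys (≢-sym (All.lookup x∉ y∈)) (xs⊆ys (there y∈))))
      (≤-reflexive (length-remove x∈ys))
    where x∈ys = xs⊆ys (here refl)

  -- Measures progress in a branching: `xs` lists vertices known to be discarded, `ys` is the
  -- surviving vertex set.
  removed≤ : ∀ {xs ys zs : List A} → Unique xs → Unique ys →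
             (∀ {x} → x ∈ xs → x ∈ zs) → (∀ {x} → x ∈ ys → x ∈ zs) →
             (∀ {x} → x ∈ xs → x ∉ ys) → length xs + length ys ≤ length zs
  removed≤ {xs} {ys} {zs} xs! ys! xs⊆ ys⊆ disj =
    ≤-trans (≤-reflexive (sym (length-++ xs)))
      (unique-⊆⇒length≤ (Unique.++⁺ xs! ys! λ (p , q) → disj p q) sub)
    where
    sub : ∀ {x} → x ∈ xs ++ ys → x ∈ zs
    sub x∈ = [ xs⊆ , ys⊆ ]′ (∈-++⁻ xs x∈)

  length-filter-split : {P : U.Pred A 0ℓ} (P? : U.Decidable P) → ∀ xs →
    length xs ≡ length (filter P? xs) + length (filter (¬? ∘ P?) xs)
  length-filter-split P? [] = refl
  length-filter-split P? (x ∷ xs) with P? x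
  ... | yes _ = cong suc (length-filter-split P? xs)
  ... | no _ = trans (cong suc (length-filter-split P? xs)) (sym (+-suc _ _))

-- Maximal independent sets in triangle-free graphs

-- Twice the Hujter–Tuza bound 2 ^ (m / 2) on even m, and slightly more than that on odd m, so that it
-- is integral and still satisfies the three recurrences of the branching below.
G : ℕ → ℕ
G 0 = 2
G 1 = 3
G (suc (suc m)) = 2 * G m

G-suc : ∀ m → G m ≤ G (suc m)
G-suc 0 = s≤s (s≤s z≤n)
G-suc 1 = n≤1+n 3
G-suc (suc (suc m)) = *-monoʳ-≤ 2 (G-suc m)

G-mono : ∀ {m n} → m ≤ n → G m ≤ G n
G-mono {m} m≤n = go (≤⇒≤′ m≤n)
  where
  go : ∀ {n} → m ≤′ n → G m ≤ G n
  go ≤′-refl = ≤-refl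
  go (≤′-step {n} p) = ≤-trans (go p) (G-suc n)

-- For a vertex of degree at least three: leaving it out discards one vertex, taking it discards at
-- least four. For even `m` this is an equality, so `G 1` cannot exceed 3; the case `m` = 1 needs 8
-- ≤ 3 * `G 1`. Hence 3 is the only possible value.
G-branch₃ : ∀ m → G (3 + m) + G m ≤ G (4 + m)
G-branch₃ 0 = ≤-refl
G-branch₃ 1 = n≤1+n 11
G-branch₃ (suc (suc m)) =
  ≤-trans (≤-reflexive (sym (*-distribˡ-+ 2 (G (3 + m)) (G m)))) (*-monoʳ-≤ 2 (G-branch₃ m))

-- For a vertex of degree two: two branches lose at least three vertices and one loses at least
-- four. The recurrence for degree one, two branches losing two vertices each, is the defining
-- equation of `G`.
G-branch₂ : ∀ m → 2 * G (1 + m) + G m ≤ G (4 + m)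
G-branch₂ 0 = ≤-refl
G-branch₂ 1 = n≤1+n 11
G-branch₂ (suc (suc m)) =
  ≤-trans (≤-reflexive (sym (*-distribˡ-+ 2 (2 * G (1 + m)) (G m)))) (*-monoʳ-≤ 2 (G-branch₂ m))

-- Independent sets enter as traces of abstract objects `X` on the vertices, because the objects
-- will be graphs H and the trace of H its edges in F. The field `separated` makes the trace
-- injective.
module HujterTuza
  {X V : Set} (_≟_ : DecidableEquality V)
  (Mem : X → V → Set) (mem? : Decidable Mem)
  (L : Rel V 0ℓ) (L? : Decidable L) (L-sym : Symmetric L)
  where

  -- The objects in xs are never cut down when branching: only the set U of undecided vertices shrinks,
  -- and the objects left in xs agree outside U.
  record Problem (U : List V) (xs : List X) : Set where
    field
      U-unique      : Unique U
      xs-unique     : Unique xs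
      triangle-free : ∀ {u v w} → u ∈ U → v ∈ U → w ∈ U → L u v → L v w → ¬ L u w
      separated     : ∀ {A B} → A ∈ xs → B ∈ xs → (∀ {v} → v ∈ U → Mem A v ⇔ Mem B v) → A ≡ B
      independent   : ∀ {A u v} → A ∈ xs → u ∈ U → v ∈ U → Mem A u → Mem A v → ¬ L u v
      maximal       : ∀ {A u} → A ∈ xs → u ∈ U → ¬ Mem A u → ∃[ v ] (v ∈ U × Mem A v × L u v)

  far? : ∀ v → U.Decidable (λ u → u ≢ v × ¬ L v u)
  far? v u = ¬? (u ≟ v) ×-dec ¬? (L? v u)

  with-vertex without-vertex : V → List X → List X
  with-vertex    v = filter (λ A → mem? A v)
  without-vertex v = filter (¬? ∘ λ A → mem? A v)

  delete-ball delete : V → List V → List V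
  delete-ball v = filter (far? v)
  delete      v = filter (λ u → ¬? (u ≟ v))

  module _ {U : List V} {xs : List X} (P : Problem U xs) where
    open Problem P

    -- An object containing `v` contains no neighbour of `v`, so the whole ball is decided. The
    -- blocker of a vertex `u` outside the ball stays outside too: it is not `v`, which is not
    -- adjacent to `u`, and not a neighbour of `v`, by independence.
    restrict-with : ∀ {v} → v ∈ U → Problem (delete-ball v U) (with-vertex v xs)
    restrict-with {v} v∈U = record
      { U-unique      = Unique.filter⁺ (far? v) U-unique
      ; xs-unique     = Unique.filter⁺ (λ A → mem? A v) xs-unique
      ; triangle-free = λ p q r → triangle-free (U⁻ p) (U⁻ q) (U⁻ r)
      ; separated     = sep
      ; independent   = λ p q r → independent (proj₁ (x⁻ p)) (U⁻ q) (U⁻ r)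
      ; maximal       = max
      }
      where
      x⁻ : ∀ {A} → A ∈ with-vertex v xs → A ∈ xs × Mem A v
      x⁻ = ∈-filter⁻ (λ A → mem? A v)
      U⁻ : ∀ {u} → u ∈ delete-ball v U → u ∈ U
      U⁻ p = proj₁ (∈-filter⁻ (far? v) p)
      agree : ∀ {A B u} → A ∈ with-vertex v xs → B ∈ with-vertex v xs →
              (u ∈ delete-ball v U → Mem A u → Mem B u) → u ∈ U → Mem A u → Mem B u
      agree {u = u} A∈ B∈ h u∈U Au with u ≟ v
      ... | yes refl = proj₂ (x⁻ B∈)
      ... | no u≢v with L? v u
      ...   | yes l = contradiction l (independent (proj₁ (x⁻ A∈)) v∈U u∈U (proj₂ (x⁻ A∈)) Au)
      ...   | no ¬l = h (∈-filter⁺ (far? v) u∈U (u≢v , ¬l)) Au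
      sep : ∀ {A B} → A ∈ with-vertex v xs → B ∈ with-vertex v xs →
            (∀ {u} → u ∈ delete-ball v U → Mem A u ⇔ Mem B u) → A ≡ B
      sep A∈ B∈ h = separated (proj₁ (x⁻ A∈)) (proj₁ (x⁻ B∈)) λ u∈U →
        mk⇔ (agree A∈ B∈ (Equivalence.to ∘ h) u∈U) (agree B∈ A∈ (Equivalence.from ∘ h) u∈U)
      max : ∀ {A u} → A ∈ with-vertex v xs → u ∈ delete-ball v U → ¬ Mem A u →
            ∃[ w ] (w ∈ delete-ball v U × Mem A w × L u w)
      max {u = u} A∈ u∈ ¬Au =
        let u∈U , _ , ¬Lvu = ∈-filter⁻ (far? v) {xs = U} u∈
            A∈xs , Av      = x⁻ A∈
            w , w∈U , Aw , Luw = maximal A∈xs u∈U ¬Au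
        in w , ∈-filter⁺ (far? v) w∈U
                 ((λ w≡v → ¬Lvu (L-sym (subst (L u) w≡v Luw))) , independent A∈xs v∈U w∈U Av Aw)
             , Aw , Luw

    -- An object without `v` never uses `v` as a blocker, so maximality survives the deletion. What
    -- is lost is that `v` itself needs a blocker; branches that rely on this read it off the larger
    -- problem.
    restrict-without : ∀ v → Problem (delete v U) (without-vertex v xs)
    restrict-without v = record
      { U-unique      = Unique.filter⁺ v? U-unique
      ; xs-unique     = Unique.filter⁺ (¬? ∘ λ A → mem? A v) xs-unique
      ; triangle-free = λ p q r → triangle-free (U⁻ p) (U⁻ q) (U⁻ r)
      ; separated     = sep
      ; independent   = λ p q r → independent (proj₁ (x⁻ p)) (U⁻ q) (U⁻ r)
      ; maximal       = max
      }
      where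
      v? : U.Decidable (_≢ v)
      v? u = ¬? (u ≟ v)
      x⁻ : ∀ {A} → A ∈ without-vertex v xs → A ∈ xs × ¬ Mem A v
      x⁻ = ∈-filter⁻ (¬? ∘ λ A → mem? A v)
      U⁻ : ∀ {u} → u ∈ delete v U → u ∈ U
      U⁻ p = proj₁ (∈-filter⁻ v? p)
      agree : ∀ {A B u} → A ∈ without-vertex v xs → B ∈ without-vertex v xs →
              (u ∈ delete v U → Mem A u → Mem B u) → u ∈ U → Mem A u → Mem B u
      agree {u = u} A∈ B∈ h u∈U Au with u ≟ v
      ... | yes refl = contradiction Au (proj₂ (x⁻ A∈))
      ... | no u≢v = h (∈-filter⁺ v? u∈U u≢v) Au
      sep : ∀ {A B} → A ∈ without-vertex v xs → B ∈ without-vertex v xs →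
            (∀ {u} → u ∈ delete v U → Mem A u ⇔ Mem B u) → A ≡ B
      sep A∈ B∈ h = separated (proj₁ (x⁻ A∈)) (proj₁ (x⁻ B∈)) λ u∈U →
        mk⇔ (agree A∈ B∈ (Equivalence.to ∘ h) u∈U) (agree B∈ A∈ (Equivalence.from ∘ h) u∈U)
      max : ∀ {A u} → A ∈ without-vertex v xs → u ∈ delete v U → ¬ Mem A u →
            ∃[ w ] (w ∈ delete v U × Mem A w × L u w)
      max {A} A∈ u∈ ¬Au =
        let A∈xs , ¬Av = x⁻ A∈
            w , w∈U , Aw , Luw = maximal A∈xs (U⁻ u∈) ¬Au
        in w , ∈-filter⁺ v? w∈U (λ w≡v → ¬Av (subst (Mem A) w≡v Aw)) , Aw , Luw

    length-split : ∀ v → length xs ≡ length (with-vertex v xs) + length (without-vertex v xs)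
    length-split v = length-filter-split (λ A → mem? A v) xs

    Bounded : Set
    Bounded = 2 * length xs ≤ G (length U)

  Smaller : List V → Set
  Smaller U = ∀ {U′ xs′} (P : Problem U′ xs′) → length U′ < length U → Bounded P

  module Step {U : List V} {xs : List X} (P : Problem U xs) (smaller : Smaller U) where
    open Problem P

    smaller-G : ∀ {U′ xs′} (P′ : Problem U′ xs′) d {m} → length U ≡ suc d + m →
                suc d + length U′ ≤ length U → 2 * length xs′ ≤ G m
    smaller-G P′ d eq le = ≤-trans
      (smaller P′ (≤-trans (s≤s (m≤n+m _ d)) le))
      (G-mono (+-cancelˡ-≤ (suc d) _ _ (≤-trans le (≤-reflexive eq))))

    sum-bound : ∀ a b {c d} → length xs ≡ a + b → 2 * a ≤ c → 2 * b ≤ d → 2 * length xs ≤ c + d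
    sum-bound a b eq p q = ≤-trans (≤-reflexive (trans (cong (2 *_) eq) (*-distribˡ-+ 2 a b))) (+-mono-≤ p q)

    size : ∀ {k} → k ≤ length U → ∃[ m ] length U ≡ k + m
    size k≤ = _ , sym (m+[n∸m]≡n k≤)

    deleted : ∀ {ys U′ xs′} → Problem U′ xs′ → (∀ {x} → x ∈ U′ → x ∈ U) → Unique ys → All (_∈ U) ys → All (_∉ U′) ys →
              length ys + length U′ ≤ length U
    deleted P′ sub ys! ys⊆ ys∉ = removed≤ ys! (Problem.U-unique P′) (All.lookup ys⊆) sub (All.lookup ys∉)

    delete-sub : ∀ {v U₁} → (∀ {x} → x ∈ U₁ → x ∈ U) → ∀ {x} → x ∈ delete v U₁ → x ∈ U
    delete-sub {v} {U₁} f x∈ = f (proj₁ (∈-filter⁻ (λ u → ¬? (u ≟ v)) {xs = U₁} x∈))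

    ball-sub : ∀ {v U₁} → (∀ {x} → x ∈ U₁ → x ∈ U) → ∀ {x} → x ∈ delete-ball v U₁ → x ∈ U
    ball-sub {v} {U₁} f x∈ = f (proj₁ (∈-filter⁻ (far? v) {xs = U₁} x∈))

    v∉delete : ∀ {v} U₁ → v ∉ delete v U₁
    v∉delete {v} U₁ p = proj₂ (∈-filter⁻ (λ u → ¬? (u ≟ v)) {xs = U₁} p) refl

    v∉ball : ∀ {v} U₁ → v ∉ delete-ball v U₁
    v∉ball {v} U₁ p = proj₁ (proj₂ (∈-filter⁻ (far? v) {xs = U₁} p)) refl

    nbr∉ball : ∀ {v u} U₁ → L v u → u ∉ delete-ball v U₁
    nbr∉ball {v} U₁ l p = proj₂ (proj₂ (∈-filter⁻ (far? v) {xs = U₁} p)) l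

    ∉ball : ∀ {v u} U₁ → u ∉ U₁ → u ∉ delete-ball v U₁
    ∉ball {v} U₁ u∉ p = u∉ (proj₁ (∈-filter⁻ (far? v) {xs = U₁} p))

    ∉delete : ∀ {v u} U₁ → u ∉ U₁ → u ∉ delete v U₁
    ∉delete {v} U₁ u∉ p = u∉ (proj₁ (∈-filter⁻ (λ u → ¬? (u ≟ v)) {xs = U₁} p))

    ¬loop : ∀ {v} → v ∈ U → ¬ L v v
    ¬loop v∈ l = triangle-free v∈ v∈ v∈ l l l

    adj⇒≢ : ∀ {u v} → u ∈ U → L u v → u ≢ v
    adj⇒≢ u∈ l refl = ¬loop u∈ l

    nbrs : V → List V
    nbrs v = filter (L? v) U

    nbr⁻ : ∀ {v u ns} → nbrs v ≡ ns → u ∈ ns → u ∈ U × L v u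
    nbr⁻ {v} refl = ∈-filter⁻ (L? v)

    nbr⁺ : ∀ {v u ns} → nbrs v ≡ ns → u ∈ U → L v u → u ∈ ns
    nbr⁺ {v} refl = ∈-filter⁺ (L? v)

    nbrs! : ∀ {v ns} → nbrs v ≡ ns → Unique ns
    nbrs! {v} refl = Unique.filter⁺ (L? v) U-unique

    -- Nothing can block an isolated vertex, so every object contains it and there is a single
    -- branch.
    degree-0 : ∀ {v} → v ∈ U → nbrs v ≡ [] → Bounded P
    degree-0 {v} v∈ eq = case size {1} (≤-trans (m≤m+n 1 _) d₁) of λ where
        (m , eqm) → ≤-trans (sum-bound (length (with-vertex v xs)) 0 (trans (length-split P v) (cong (length (with-vertex v xs) +_) none))
          (smaller-G (restrict-with P v∈) 0 eqm d₁) (z≤n {0}))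
          (≤-trans (≤-reflexive (+-identityʳ _)) (G-mono (≤-trans (n≤1+n m) (≤-reflexive (sym eqm)))))
      where
      d₁ = deleted {v ∷ []} (restrict-with P v∈) (ball-sub id) ([] ∷ []) (v∈ ∷ []) (v∉ball U ∷ [])
      none : length (without-vertex v xs) ≡ 0
      none with without-vertex v xs in weq
      ... | [] = refl
      ... | A ∷ As with A∈ , ¬Av ← ∈-filter⁻ (¬? ∘ λ A → mem? A v) {xs = xs} (subst (A ∈_) (sym weq) (here refl))
                   with w , w∈ , _ , l ← maximal A∈ v∈ ¬Av
                   with () ← nbr⁺ eq w∈ l

    without-v : ∀ {v A} → A ∈ without-vertex v xs → A ∈ xs × ¬ Mem A v
    without-v {v} = ∈-filter⁻ (¬? ∘ λ A → mem? A v)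

    all-with : ∀ {u} ys → (∀ {A} → A ∈ ys → Mem A u) → with-vertex u ys ≡ ys
    all-with {u} ys h = filter-all (λ A → mem? A u) (All.tabulate h)

    -- If `v` is left out, its only neighbour `u` must be the blocker. So either `v` or `u` is
    -- taken, and each choice discards both.
    degree-1 : ∀ {v u} → v ∈ U → nbrs v ≡ u ∷ [] → Bounded P
    degree-1 {v} {u} v∈ eq = case size {2} (≤-trans (m≤m+n 2 _) d₁) of λ where
        (m , eqm) → ≤-trans (sum-bound (length (with-vertex v xs)) (length (without-vertex v xs)) (length-split P v)
            (smaller-G (restrict-with P v∈) 1 eqm d₁)
            (subst (λ ys → 2 * length ys ≤ G m) (all-with _ forced) (smaller-G P₂ 1 eqm d₂)))
          (≤-reflexive (trans (cong (G m +_) (sym (+-identityʳ (G m)))) (cong G (sym eqm))))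
      where
      u∈ = proj₁ (nbr⁻ eq (here refl))
      vu = proj₂ (nbr⁻ eq (here refl))
      u≢v = ≢-sym (adj⇒≢ v∈ vu)
      u∈′ = ∈-filter⁺ (λ u → ¬? (u ≟ v)) u∈ u≢v
      P₂ = restrict-with (restrict-without P v) u∈′
      two! : Unique (v ∷ u ∷ [])
      two! = (≢-sym u≢v ∷ []) ∷ [] ∷ []
      d₁ = deleted {v ∷ u ∷ []} (restrict-with P v∈) (ball-sub id) two! (v∈ ∷ u∈ ∷ []) (v∉ball U ∷ nbr∉ball U vu ∷ [])
      d₂ = deleted {v ∷ u ∷ []} P₂ (ball-sub (delete-sub id)) two! (v∈ ∷ u∈ ∷ [])
             (∉ball (delete v U) (v∉delete U) ∷ v∉ball (delete v U) ∷ [])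
      forced : ∀ {A} → A ∈ without-vertex v xs → Mem A u
      forced A∈ with A∈xs , ¬Av ← without-v A∈ with w , w∈ , Aw , l ← maximal A∈xs v∈ ¬Av with nbr⁺ eq w∈ l
      ... | here refl = Aw

    degree-≥3 : ∀ {v a b c ns} → v ∈ U → nbrs v ≡ a ∷ b ∷ c ∷ ns → Bounded P
    degree-≥3 {v} {a} {b} {c} v∈ eq with nbrs! eq
    ... | (a≢b ∷ a≢c ∷ _) ∷ (b≢c ∷ _) ∷ _ = case size {4} (≤-trans (m≤m+n 4 _) d₁) of λ where
        (m , eqm) → ≤-trans (sum-bound (length (without-vertex v xs)) (length (with-vertex v xs))
            (trans (length-split P v) (+-comm (length (with-vertex v xs)) _))
            (smaller-G (restrict-without P v) 0 eqm d₂)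
            (smaller-G (restrict-with P v∈) 3 eqm d₁))
          (≤-trans (G-branch₃ m) (≤-reflexive (cong G (sym eqm))))
      where
      a∈ = nbr⁻ eq (here refl)
      b∈ = nbr⁻ eq (there (here refl))
      c∈ = nbr⁻ eq (there (there (here refl)))
      v≢ : ∀ {x} → x ∈ U × L v x → v ≢ x
      v≢ p = adj⇒≢ v∈ (proj₂ p)
      d₁ = deleted {v ∷ a ∷ b ∷ c ∷ []} (restrict-with P v∈) (ball-sub id)
             ((v≢ a∈ ∷ v≢ b∈ ∷ v≢ c∈ ∷ []) ∷ (a≢b ∷ a≢c ∷ []) ∷ (b≢c ∷ []) ∷ [] ∷ [])
             (v∈ ∷ proj₁ a∈ ∷ proj₁ b∈ ∷ proj₁ c∈ ∷ [])
             (v∉ball U ∷ nbr∉ball U (proj₂ a∈) ∷ nbr∉ball U (proj₂ b∈) ∷ nbr∉ball U (proj₂ c∈) ∷ [])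
      d₂ = deleted {v ∷ []} (restrict-without P v) (delete-sub id) ([] ∷ []) (v∈ ∷ []) (v∉delete U ∷ [])

    -- Branching at u settles the bound unless u has degree two.
    second-neighbour : ∀ {u v} → u ∈ U → v ∈ U → L u v → Bounded P ⊎ ∃[ z ] (z ∈ U × L u z × z ≢ v)
    second-neighbour {u} {v} u∈ v∈ l with nbrs u in eq
    ... | [] = inj₁ (degree-0 u∈ eq)
    ... | _ ∷ [] = inj₁ (degree-1 u∈ eq)
    ... | _ ∷ _ ∷ _ ∷ _ = inj₁ (degree-≥3 u∈ eq)
    ... | a ∷ b ∷ [] with nbrs! eq | a ≟ v
    ...   | _ | no a≢v = inj₂ (a , proj₁ a∈ , proj₂ a∈ , a≢v)
      where a∈ = nbr⁻ eq (here refl)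
    ...   | (a≢b ∷ []) ∷ _ | yes refl = inj₂ (b , proj₁ b∈ , proj₂ b∈ , ≢-sym a≢b)
      where b∈ = nbr⁻ eq (there (here refl))

    -- Three branches: take `v`; leave `v` and take `u`; leave both, which forces `w` as the blocker
    -- of `v`. They discard v, u, w; then v, u and the other neighbour `y` of `u`; then v, u, w and
    -- the other neighbour `z` of `w`. Triangle-freeness gives `z` ≠ `u`, so the last four are
    -- distinct.
    degree-2 : ∀ {v u w} → v ∈ U → nbrs v ≡ u ∷ w ∷ [] → Bounded P
    degree-2 {v} {u} {w} v∈ eq
      with second-neighbour (proj₁ (nbr⁻ eq (here refl))) v∈ (L-sym (proj₂ (nbr⁻ eq (here refl))))
         | second-neighbour (proj₁ (nbr⁻ eq (there (here refl)))) v∈ (L-sym (proj₂ (nbr⁻ eq (there (here refl)))))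
    ... | inj₁ b | _ = b
    ... | inj₂ _ | inj₁ b = b
    ... | inj₂ (y , y∈ , uy , y≢v) | inj₂ (z , z∈ , wz , z≢v) with nbrs! eq
    ...   | (u≢w ∷ []) ∷ _ = case size {4} (≤-trans (m≤m+n 4 _) d₃) of λ where
        (m , eqm) → ≤-trans (sum-bound (#v + #u) #w
            (trans (length-split P v)
              (trans (cong (#v +_) (length-split P₁ u)) (sym (+-assoc #v #u #w))))
            (≤-trans (≤-reflexive (*-distribˡ-+ 2 #v #u))
              (≤-trans (+-mono-≤ (smaller-G (restrict-with P v∈) 2 (trans eqm (sym (+-suc 3 m))) d₁)
                                 (smaller-G P₂ 2 (trans eqm (sym (+-suc 3 m))) d₂))
                (≤-reflexive (cong (G (1 + m) +_) (sym (+-identityʳ _))))))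
            (subst (λ ys → 2 * length ys ≤ G m) (all-with _ forced) (smaller-G P₃ 3 eqm d₃)))
          (≤-trans (G-branch₂ m) (≤-reflexive (cong G (sym eqm))))
      where
      #v = length (with-vertex v xs)
      #u = length (with-vertex u (without-vertex v xs))
      #w = length (without-vertex u (without-vertex v xs))
      u∈ = proj₁ (nbr⁻ eq (here refl))
      vu = proj₂ (nbr⁻ eq (here refl))
      w∈ = proj₁ (nbr⁻ eq (there (here refl)))
      vw = proj₂ (nbr⁻ eq (there (here refl)))
      v≢u = adj⇒≢ v∈ vu
      v≢w = adj⇒≢ v∈ vw
      ¬uw : ¬ L u w
      ¬uw l = triangle-free v∈ u∈ w∈ vu l vw
      P₁ = restrict-without P v
      u∈₁ = ∈-filter⁺ (λ x → ¬? (x ≟ v)) u∈ (≢-sym v≢u)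
      P₂ = restrict-with P₁ u∈₁
      P₁′ = restrict-without P₁ u
      w∈₁′ : w ∈ delete u (delete v U)
      w∈₁′ = ∈-filter⁺ (λ x → ¬? (x ≟ u)) (∈-filter⁺ (λ x → ¬? (x ≟ v)) w∈ (≢-sym v≢w)) (≢-sym u≢w)
      P₃ = restrict-with P₁′ w∈₁′
      forced : ∀ {A} → A ∈ without-vertex u (without-vertex v xs) → Mem A w
      forced A∈ with A∈₁ , ¬Au ← ∈-filter⁻ (¬? ∘ λ A → mem? A u) {xs = without-vertex v xs} A∈
                with A∈xs , ¬Av ← without-v A∈₁
                with x , x∈ , Ax , l ← maximal A∈xs v∈ ¬Av with nbr⁺ eq x∈ l
      ... | here refl = contradiction Ax ¬Au
      ... | there (here refl) = Ax
      d₁ = deleted {v ∷ u ∷ w ∷ []} (restrict-with P v∈) (ball-sub id)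
             ((v≢u ∷ v≢w ∷ []) ∷ (u≢w ∷ []) ∷ [] ∷ []) (v∈ ∷ u∈ ∷ w∈ ∷ [])
             (v∉ball U ∷ nbr∉ball U vu ∷ nbr∉ball U vw ∷ [])
      d₂ = deleted {v ∷ u ∷ y ∷ []} P₂ (ball-sub (delete-sub id))
             ((v≢u ∷ ≢-sym y≢v ∷ []) ∷ (adj⇒≢ u∈ uy ∷ []) ∷ [] ∷ []) (v∈ ∷ u∈ ∷ y∈ ∷ [])
             (∉ball (delete v U) (v∉delete U) ∷ v∉ball (delete v U) ∷ nbr∉ball (delete v U) uy ∷ [])
      d₃ = deleted {v ∷ u ∷ w ∷ z ∷ []} P₃ (ball-sub (delete-sub (delete-sub id)))
             ((v≢u ∷ v≢w ∷ ≢-sym z≢v ∷ []) ∷ (u≢w ∷ (λ { refl → ¬uw (L-sym wz) }) ∷ []) ∷ (adj⇒≢ w∈ wz ∷ []) ∷ [] ∷ [])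
             (v∈ ∷ u∈ ∷ w∈ ∷ z∈ ∷ [])
             (∉ball U″ (∉delete (delete v U) (v∉delete U)) ∷ ∉ball U″ (v∉delete (delete v U))
               ∷ v∉ball U″ ∷ nbr∉ball U″ wz ∷ [])
        where U″ = delete u (delete v U)

    bounded-at : ∀ {v} → v ∈ U → Bounded P
    bounded-at {v} v∈ with nbrs v in eq
    ... | [] = degree-0 v∈ eq
    ... | _ ∷ [] = degree-1 v∈ eq
    ... | _ ∷ _ ∷ [] = degree-2 v∈ eq
    ... | _ ∷ _ ∷ _ ∷ _ = degree-≥3 v∈ eq

  -- Once no vertex is left, `separated` holds vacuously between any two objects, so at most one
  -- remains; this is the origin of `G 0` = 2.
  bounded′ : ∀ n {U xs} (P : Problem U xs) → length U ≤ n → Bounded P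
  bounded′ n {[]} {[]} P _ = z≤n
  bounded′ n {[]} {_ ∷ []} P _ = ≤-refl
  bounded′ n {[]} {A ∷ B ∷ _} P _ with (A≢B ∷ _) ∷ _ ← Problem.xs-unique P =
    contradiction (Problem.separated P (here refl) (there (here refl)) λ ()) A≢B
  bounded′ (suc n) {v ∷ U} P (s≤s le) =
    Step.bounded-at P (λ P′ lt → bounded′ n P′ (≤-trans (s≤s⁻¹ lt) le)) (here refl)

  bounded : ∀ {U xs} → Problem U xs → 2 * length xs ≤ G (length U)
  bounded P = bounded′ _ P ≤-refl

-- Double sums and Mantel's theorem

⟦_⟧ : {P : Set} → Dec P → ℕ
⟦ p? ⟧ = if does p? then 1 else 0

module _ {P : Set} where

  ⟦⟧≤1 : (p? : Dec P) → ⟦ p? ⟧ ≤ 1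
  ⟦⟧≤1 (yes _) = ≤-refl
  ⟦⟧≤1 (no _) = z≤n

  ⟦⟧-yes : (p? : Dec P) → P → ⟦ p? ⟧ ≡ 1
  ⟦⟧-yes (yes _) _ = refl
  ⟦⟧-yes (no ¬p) p = contradiction p ¬p

⟦⟧-mono : {P Q : Set} (p? : Dec P) (q? : Dec Q) → (P → Q) → ⟦ p? ⟧ ≤ ⟦ q? ⟧
⟦⟧-mono (yes p) q? f = ≤-reflexive (sym (⟦⟧-yes q? (f p)))
⟦⟧-mono (no _) _ _ = z≤n

sum-mono : ∀ {n} {f g : Fin n → ℕ} → (∀ i → f i ≤ g i) → sum f ≤ sum g
sum-mono {zero} h = z≤n
sum-mono {suc n} h = +-mono-≤ (h zero) (sum-mono (h ∘ suc))

sum-const : ∀ n c → sum {n} (λ _ → c) ≡ n * c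
sum-const zero c = refl
sum-const (suc n) c = cong (c +_) (sum-const n c)

∑∑ : ∀ {n} → (Fin n → Fin n → ℕ) → ℕ
∑∑ f = sum λ i → sum λ j → f i j

∑∑-mono : ∀ {n} {f g : Fin n → Fin n → ℕ} → (∀ i j → f i j ≤ g i j) → ∑∑ f ≤ ∑∑ g
∑∑-mono h = sum-mono λ i → sum-mono (h i)

∑∑-cong : ∀ {n} {f g : Fin n → Fin n → ℕ} → (∀ i j → f i j ≡ g i j) → ∑∑ f ≡ ∑∑ g
∑∑-cong h = sum-cong-≗ λ i → sum-cong-≗ (h i)

∑∑-distrib-+ : ∀ {n} (f g : Fin n → Fin n → ℕ) → ∑∑ (λ i j → f i j + g i j) ≡ ∑∑ f + ∑∑ g
∑∑-distrib-+ f g = trans (sum-cong-≗ λ i → ∑-distrib-+ (f i) (g i)) (∑-distrib-+ (λ i → sum (f i)) (λ i → sum (g i)))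

∑∑-distribˡ : ∀ {n} c (f : Fin n → Fin n → ℕ) → c * ∑∑ f ≡ ∑∑ (λ i j → c * f i j)
∑∑-distribˡ c f = trans (*-distribˡ-sum c (λ i → sum (f i))) (sum-cong-≗ λ i → *-distribˡ-sum c (f i))

∑∑-transpose : ∀ {n} (f : Fin n → Fin n → ℕ) → ∑∑ f ≡ ∑∑ (λ i j → f j i)
∑∑-transpose f = ∑-comm f

∑∑-const : ∀ n c → ∑∑ {n} (λ _ _ → c) ≡ n * n * c
∑∑-const n c = trans (sum-const n _) (trans (cong (n *_) (sum-const n c)) (sym (*-assoc n n c)))

argmax : ∀ {n} (f : Fin (suc n) → ℕ) → ∃[ v ] (∀ x → f x ≤ f v)
argmax {zero} f = zero , λ { zero → ≤-refl }
argmax {suc n} f with argmax (f ∘ suc)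
... | v , h with f zero ≤? f (suc v)
...   | yes p = suc v , λ { zero → p ; (suc x) → h x }
...   | no ¬p = zero , λ { zero → ≤-refl ; (suc x) → ≤-trans (h x) (<⇒≤ (≰⇒> ¬p)) }

4ab≤[a+b]² : ∀ a b → 4 * (a * b) ≤ (a + b) * (a + b)
4ab≤[a+b]² a b with ≤-total a b
... | inj₁ a≤b with d , refl ← m≤n⇒∃[o]m+o≡n a≤b = ≤-trans (m≤m+n _ (d * d)) (≤-reflexive (eq a d))
  where
  eq : ∀ a d → 4 * (a * (a + d)) + d * d ≡ (a + (a + d)) * (a + (a + d))
  eq = solve-∀
... | inj₂ b≤a with d , refl ← m≤n⇒∃[o]m+o≡n b≤a = ≤-trans (m≤m+n _ (d * d)) (≤-reflexive (eq b d))
  where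
  eq : ∀ b d → 4 * ((b + d) * b) + d * d ≡ (b + d + b) * (b + d + b)
  eq = solve-∀

-- Each edge has an endpoint outside the (independent) neighbourhood of a vertex v of maximum degree Δ,
-- so there are at most (n − Δ) Δ edges.
mantel : ∀ {n} {F : Rel (Fin n) 0ℓ} (F? : Decidable F) → Symmetric F → TriangleFree F →
         4 * ∑∑ (λ x y → ⟦ (x Fin.<? y) ×-dec F? x y ⟧) ≤ n * n
mantel {zero} F? F-sym F-free = z≤n
mantel {suc n} {F} F? F-sym F-free = begin
  4 * ∑∑ (λ x y → ⟦ (x Fin.<? y) ×-dec F? x y ⟧)
    ≤⟨ *-monoʳ-≤ 4 (∑∑-mono cover) ⟩
  4 * ∑∑ (λ x y → l x y * (f x y * c x) + l x y * (f x y * c y))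
    ≡⟨ cong (4 *_) (∑∑-distrib-+ (λ x y → l x y * (f x y * c x)) (λ x y → l x y * (f x y * c y))) ⟩
  4 * (∑∑ (λ x y → l x y * (f x y * c x)) + ∑∑ (λ x y → l x y * (f x y * c y)))
    -- Swapping the variables in the second half charges every edge to an endpoint x outside the
    -- neighbourhood of `v`; since x < y and y < x exclude each other, no ordered pair is charged
    -- twice.
    ≡⟨ cong (λ s → 4 * (∑∑ (λ x y → l x y * (f x y * c x)) + s)) (∑∑-transpose (λ x y → l x y * (f x y * c y))) ⟩
  4 * (∑∑ (λ x y → l x y * (f x y * c x)) + ∑∑ (λ x y → l y x * (f y x * c x)))
    ≡⟨ cong (4 *_) (∑∑-distrib-+ (λ x y → l x y * (f x y * c x)) (λ x y → l y x * (f y x * c x))) ⟨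
  4 * ∑∑ (λ x y → l x y * (f x y * c x) + l y x * (f y x * c x))
    ≤⟨ *-monoʳ-≤ 4 (∑∑-mono once) ⟩
  4 * ∑∑ (λ x y → f x y * c x)
    ≡⟨ cong (4 *_) (sum-cong-≗ λ x → sym (*-distribʳ-sum (c x) (f x))) ⟩
  4 * sum (λ x → deg x * c x)
    ≤⟨ *-monoʳ-≤ 4 (sum-mono λ x → *-monoˡ-≤ (c x) (deg≤ x)) ⟩
  4 * sum (λ x → deg v * c x)
    ≡⟨ cong (4 *_) (sym (*-distribˡ-sum (deg v) c)) ⟩
  4 * (deg v * sum c)
    ≤⟨ 4ab≤[a+b]² (deg v) (sum c) ⟩
  (deg v + sum c) * (deg v + sum c)
    ≡⟨ cong (λ m → m * m) total ⟩
  suc n * suc n ∎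
  where
  open ≤-Reasoning
  f : Fin (suc n) → Fin (suc n) → ℕ
  f x y = ⟦ F? x y ⟧
  l : Fin (suc n) → Fin (suc n) → ℕ
  l x y = ⟦ x Fin.<? y ⟧
  deg : Fin (suc n) → ℕ
  deg x = sum (f x)
  v = proj₁ (argmax deg)
  deg≤ = proj₂ (argmax deg)
  c : Fin (suc n) → ℕ
  c x = ⟦ ¬? (F? v x) ⟧
  total : deg v + sum c ≡ suc n
  total = trans (sym (∑-distrib-+ (f v) c)) (trans (sum-cong-≗ one) (trans (sum-const (suc n) 1) (*-identityʳ _)))
    where
    one : ∀ x → f v x + c x ≡ 1
    one x with F? v x
    ... | yes _ = refl
    ... | no _ = refl
  cover′ : {P Q R S : Set} (p? : Dec P) (q? : Dec Q) (r? : Dec R) (s? : Dec S) → (Q → R → ¬ S) →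
           ⟦ p? ×-dec q? ⟧ ≤ ⟦ p? ⟧ * (⟦ q? ⟧ * ⟦ ¬? r? ⟧) + ⟦ p? ⟧ * (⟦ q? ⟧ * ⟦ ¬? s? ⟧)
  cover′ (no _) _ _ _ _ = z≤n
  cover′ (yes _) (no _) _ _ _ = z≤n
  cover′ (yes _) (yes _) (no _) _ _ = s≤s z≤n
  cover′ (yes _) (yes _) (yes _) (no _) _ = s≤s z≤n
  cover′ (yes _) (yes q) (yes r) (yes s) h = contradiction s (h q r)
  cover : ∀ x y → ⟦ (x Fin.<? y) ×-dec F? x y ⟧ ≤ l x y * (f x y * c x) + l x y * (f x y * c y)
  cover x y = cover′ (x Fin.<? y) (F? x y) (F? v x) (F? v y) λ xy vx vy → F-free (v , x , y , vx , xy , vy)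
  once′ : {P Q : Set} (p? : Dec P) (q? : Dec Q) → (P → ¬ Q) → ∀ a → ⟦ p? ⟧ * a + ⟦ q? ⟧ * a ≤ a
  once′ (yes p) (yes q) h a = contradiction q (h p)
  once′ (yes p) (no _) h a = ≤-reflexive (trans (+-identityʳ _) (*-identityˡ _))
  once′ (no _) (yes _) h a = ≤-reflexive (*-identityˡ a)
  once′ (no _) (no _) h a = z≤n
  f-sym : ∀ x y → f y x ≡ f x y
  f-sym x y = ≤-antisym (⟦⟧-mono (F? y x) (F? x y) F-sym) (⟦⟧-mono (F? x y) (F? y x) F-sym)
  once : ∀ x y → l x y * (f x y * c x) + l y x * (f y x * c x) ≤ f x y * c x
  once x y rewrite f-sym x y = once′ (x Fin.<? y) (y Fin.<? x) <-asym (f x y * c x)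

length-filter-map : ∀ {A B : Set} {P : U.Pred B 0ℓ} (P? : U.Decidable P) (f : A → B) {n} (t : Fin n → A) →
  length (filter P? (map f (tabulate t))) ≡ sum (λ i → ⟦ P? (f (t i)) ⟧)
length-filter-map P? f {zero} t = refl
length-filter-map P? f {suc n} t with P? (f (t zero))
... | yes _ = cong suc (length-filter-map P? f (t ∘ suc))
... | no _ = length-filter-map P? f (t ∘ suc)

length-filter-cartesianProduct : ∀ {A B : Set} {P : U.Pred (A × B) 0ℓ} (P? : U.Decidable P)
  {m n} (s : Fin m → A) (t : Fin n → B) →
  length (filter P? (cartesianProduct (tabulate s) (tabulate t))) ≡ sum (λ i → sum λ j → ⟦ P? (s i , t j) ⟧)
length-filter-cartesianProduct P? {zero} s t = refl
length-filter-cartesianProduct P? {suc m} s t =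
  trans (cong length (filter-++ P? (map (s zero ,_) (tabulate t)) _))
    (trans (length-++ (filter P? (map (s zero ,_) (tabulate t))))
      (cong₂ _+_ (length-filter-map P? (s zero ,_) t) (length-filter-cartesianProduct P? (s ∘ suc) t)))

-- The link graph

lookup-ext : ∀ {A : Set} {n} {xs ys : Vec A n} → (∀ i → lookup xs i ≡ lookup ys i) → xs ≡ ys
lookup-ext {xs = xs} {ys} h = trans (sym (tabulate∘lookup xs)) (trans (tabulate-cong h) (tabulate∘lookup ys))

Adj-ext : ∀ {n} {A B : AdjacencyMatrix n} → (∀ {i j} → Adj A i j → Adj B i j) → (∀ {i j} → Adj B i j → Adj A i j) → A ≡ B
Adj-ext {A = A} {B} f g = lookup-ext λ i → lookup-ext λ j → Bool.⇔→≡ {z = true}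
  (mk⇔ ([]=⇒lookup ∘ f {i} {j} ∘ lookup⇒[]= j _) ([]=⇒lookup ∘ g {i} {j} ∘ lookup⇒[]= j _))

-- One side of the new triangle is the added edge, and the opposite vertex is the common neighbour.
-- `HasTriangle` does not demand distinct vertices, so configurations using the added pair several
-- times are dismissed separately: they give `u` = `v` or a loop of `E`, which is itself a triangle.
common-neighbour : ∀ {n} {E : Rel (Fin n) 0ℓ} → Symmetric E → TriangleFree E → ∀ {u v} → u ≢ v →
  HasTriangle (addEdge E u v) → ∃[ w ] (E u w × E v w)
common-neighbour {E = E} E-sym free {u} {v} u≢v (i , j , k , ij , jk , ik) = go ij jk ik
  where
  go : ∀ {i j k} → addEdge E u v i j → addEdge E u v j k → addEdge E u v i k → ∃[ w ] (E u w × E v w)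
  go (inj₁ a) (inj₁ b) (inj₁ c) = contradiction (_ , _ , _ , a , b , c) free
  go (inj₁ a) (inj₁ b) (inj₂ (inj₁ (refl , refl))) = _ , a , E-sym b
  go (inj₁ a) (inj₁ b) (inj₂ (inj₂ (refl , refl))) = _ , E-sym b , a
  go (inj₁ a) (inj₂ (inj₁ (refl , refl))) (inj₁ c) = _ , E-sym a , E-sym c
  go (inj₁ a) (inj₂ (inj₂ (refl , refl))) (inj₁ c) = _ , E-sym c , E-sym a
  go (inj₂ (inj₁ (refl , refl))) (inj₁ b) (inj₁ c) = _ , c , b
  go (inj₂ (inj₂ (refl , refl))) (inj₁ b) (inj₁ c) = _ , b , c
  go (inj₂ (inj₁ (refl , refl))) (inj₂ (inj₁ (p , q))) _ = contradiction (sym p) u≢v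
  go (inj₂ (inj₁ (refl , refl))) (inj₂ (inj₂ (_ , refl))) (inj₁ c) = contradiction (_ , _ , _ , c , c , c) free
  go (inj₂ (inj₁ (refl , refl))) (inj₂ (inj₂ (_ , refl))) (inj₂ (inj₁ (_ , p))) = contradiction p u≢v
  go (inj₂ (inj₁ (refl , refl))) (inj₂ (inj₂ (_ , refl))) (inj₂ (inj₂ (p , _))) = contradiction p u≢v
  go (inj₂ (inj₂ (refl , refl))) (inj₂ (inj₁ (_ , refl))) (inj₁ c) = contradiction (_ , _ , _ , c , c , c) free
  go (inj₂ (inj₂ (refl , refl))) (inj₂ (inj₁ (_ , refl))) (inj₂ (inj₁ (p , _))) = contradiction (sym p) u≢v
  go (inj₂ (inj₂ (refl , refl))) (inj₂ (inj₁ (_ , refl))) (inj₂ (inj₂ (_ , p))) = contradiction (sym p) u≢v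
  go (inj₂ (inj₂ (refl , refl))) (inj₂ (inj₂ (p , q))) _ = contradiction p u≢v
  go (inj₁ a) (inj₂ (inj₁ (refl , refl))) (inj₂ (inj₁ (refl , _))) = contradiction (_ , _ , _ , a , a , a) free
  go (inj₁ a) (inj₂ (inj₁ (refl , refl))) (inj₂ (inj₂ (_ , p))) = contradiction (sym p) u≢v
  go (inj₁ a) (inj₂ (inj₂ (refl , refl))) (inj₂ (inj₁ (_ , p))) = contradiction p u≢v
  go (inj₁ a) (inj₂ (inj₂ (refl , refl))) (inj₂ (inj₂ (refl , _))) = contradiction (_ , _ , _ , a , a , a) free
  go (inj₂ (inj₁ (refl , refl))) (inj₁ b) (inj₂ (inj₁ (_ , refl))) = contradiction (_ , _ , _ , b , b , b) free
  go (inj₂ (inj₁ (refl , refl))) (inj₁ b) (inj₂ (inj₂ (p , _))) = contradiction p u≢v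
  go (inj₂ (inj₂ (refl , refl))) (inj₁ b) (inj₂ (inj₁ (p , _))) = contradiction (sym p) u≢v
  go (inj₂ (inj₂ (refl , refl))) (inj₁ b) (inj₂ (inj₂ (_ , refl))) = contradiction (_ , _ , _ , b , b , b) free

module LinkGraph
  {n : ℕ}
  {F : Rel (Fin n) 0ℓ} (F? : Decidable F) (F-sym : Symmetric F) (F-free : TriangleFree F)
  {S : Rel (Fin n) 0ℓ} (S? : Decidable S) (S-sym : Symmetric S) (S-free : TriangleFree S)
  where

  Edge : Set
  Edge = Fin n × Fin n

  Ends : Edge → Rel (Fin n) 0ℓ
  Ends (a , b) x y = (a ≡ x × b ≡ y) ⊎ (a ≡ y × b ≡ x)

  ends? : ∀ e → Decidable (Ends e)
  ends? (a , b) x y = ((a Fin.≟ x) ×-dec (b Fin.≟ y)) ⊎-dec ((a Fin.≟ y) ×-dec (b Fin.≟ x))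

  Ends-unique : ∀ {e x y p q} → Ends e x y → Ends e p q → (x ≡ p × y ≡ q) ⊎ (x ≡ q × y ≡ p)
  Ends-unique (inj₁ (refl , refl)) (inj₁ (refl , refl)) = inj₁ (refl , refl)
  Ends-unique (inj₁ (refl , refl)) (inj₂ (refl , refl)) = inj₂ (refl , refl)
  Ends-unique (inj₂ (refl , refl)) (inj₁ (refl , refl)) = inj₂ (refl , refl)
  Ends-unique (inj₂ (refl , refl)) (inj₂ (refl , refl)) = inj₁ (refl , refl)

  Ends-rel : ∀ {R : Rel (Fin n) 0ℓ} → Symmetric R → ∀ {e x y} → Ends e x y → R (proj₁ e) (proj₂ e) → R x y
  Ends-rel R-sym (inj₁ (refl , refl)) r = r
  Ends-rel R-sym (inj₂ (refl , refl)) r = R-sym r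

  Ends-rel⁻ : ∀ {R : Rel (Fin n) 0ℓ} → Symmetric R → ∀ {e x y} → Ends e x y → R x y → R (proj₁ e) (proj₂ e)
  Ends-rel⁻ R-sym (inj₁ (refl , refl)) r = r
  Ends-rel⁻ R-sym (inj₂ (refl , refl)) r = R-sym r

  Link : Rel Edge 0ℓ
  Link e f = ∃[ x ] ∃[ y ] ∃[ z ] (Ends e x y × Ends f x z × S y z)

  link? : Decidable Link
  link? e f = Fin.any? λ x → Fin.any? λ y → Fin.any? λ z → ends? e x y ×-dec ends? f x z ×-dec S? y z

  Link-sym : Symmetric Link
  Link-sym (x , y , z , e , f , s) = x , z , y , f , e , S-sym s

  -- An edge of F that closes a triangle with two edges of S belongs to no triangle-free graph containing S.
  Eligible : Edge → Set
  Eligible (a , b) = (a Fin.< b × F a b) × ¬ (∃[ w ] (S a w × S b w))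

  eligible? : U.Decidable Eligible
  eligible? (a , b) = ((a Fin.<? b) ×-dec F? a b) ×-dec ¬? (Fin.any? λ w → S? a w ×-dec S? b w)

  ends-F : ∀ {e x y} → Eligible e → Ends e x y → F x y
  ends-F ((_ , Fe) , _) e = Ends-rel F-sym e Fe

  F-loop : ∀ {x} → ¬ F x x
  F-loop p = F-free (_ , _ , _ , p , p , p)

  S-loop : ∀ {x} → ¬ S x x
  S-loop p = S-free (_ , _ , _ , p , p , p)

  -- Three edges that pairwise share an end form a star or a triangle. In a star the three outer
  -- ends span a triangle of S; otherwise the edges are a triangle of F. The six mixed matchings of
  -- ends are degenerate and produce a loop of F or S.
  link-triangle-free : ∀ {e f g} → Eligible e → Eligible f → Eligible g → Link e f → Link f g → ¬ Link e g
  link-triangle-free Ae Af Ag (x , y , z , exy , fxz , yz) (p , q , r , fpq , gpr , qr) (s , t , w , est , gsw , tw)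
    with Ends-unique fxz fpq | Ends-unique exy est | Ends-unique gpr gsw
  ... | inj₁ (refl , refl) | inj₁ (refl , refl) | inj₁ (_ , refl)    = S-free (_ , _ , _ , yz , qr , tw)
  ... | inj₁ (refl , refl) | inj₁ (refl , refl) | inj₂ (refl , refl) = F-loop (ends-F Ag gpr)
  ... | inj₁ (refl , refl) | inj₂ (refl , refl) | inj₁ (refl , _)    = F-loop (ends-F Ae exy)
  ... | inj₁ (refl , refl) | inj₂ (refl , refl) | inj₂ (refl , refl) = S-loop tw
  ... | inj₂ (refl , refl) | inj₁ (refl , refl) | inj₁ (refl , _)    = F-loop (ends-F Af fxz)
  ... | inj₂ (refl , refl) | inj₁ (refl , refl) | inj₂ (refl , refl) = S-loop qr
  ... | inj₂ (refl , refl) | inj₂ (refl , refl) | inj₁ (refl , _)    = S-loop yz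
  ... | inj₂ (refl , refl) | inj₂ (refl , refl) | inj₂ (refl , refl) =
    F-free (_ , _ , _ , ends-F Ae exy , F-sym (ends-F Ag gpr) , ends-F Af fxz)

  edges : List Edge
  edges = filter eligible? (cartesianProduct (allFin n) (allFin n))

  edges-unique : Unique edges
  edges-unique = Unique.filter⁺ eligible? (Unique.cartesianProduct⁺ (Unique.allFin⁺ n) (Unique.allFin⁺ n))

  ∈-edges⁺ : ∀ {e} → Eligible e → e ∈ edges
  ∈-edges⁺ {a , b} = ∈-filter⁺ eligible? (∈-cartesianProduct⁺ (∈-allFin a) (∈-allFin b))

  ∈-edges⁻ : ∀ {e} → e ∈ edges → Eligible e
  ∈-edges⁻ e∈ = proj₂ (∈-filter⁻ eligible? {xs = cartesianProduct (allFin n) (allFin n)} e∈)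

  edge : ∀ {a b} → F a b → ¬ (∃[ w ] (S a w × S b w)) → ∃[ e ] (e ∈ edges × Ends e a b)
  edge {a} {b} Fab no-w with Fin.<-cmp a b
  ... | tri< a<b _ _ = (a , b) , ∈-edges⁺ ((a<b , Fab) , no-w) , inj₁ (refl , refl)
  ... | tri≈ _ refl _ = contradiction Fab F-loop
  ... | tri> _ _ b<a = (b , a) , ∈-edges⁺ ((b<a , F-sym Fab) , λ (w , p , q) → no-w (w , q , p)) , inj₂ (refl , refl)

  length-edges : 4 * length edges ≤ n * n
  length-edges = ≤-trans (*-monoʳ-≤ 4 (≤-trans (≤-reflexive (length-filter-cartesianProduct eligible? {n} {n} id id))
    (∑∑-mono λ a b → ⟦⟧-mono (eligible? (a , b)) ((a Fin.<? b) ×-dec F? a b) proj₁)))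
    (mantel F? F-sym F-free)

  Mem : AdjacencyMatrix n → Edge → Set
  Mem H (a , b) = Adj H a b

  mem? : Decidable Mem
  mem? H (a , b) = adj? H a b

  open HujterTuza (Product.≡-dec Fin._≟_ Fin._≟_) Mem mem? Link link? Link-sym

  Compatible : AdjacencyMatrix n → Set
  Compatible H = IsMaximalTriangleFreeGraph H × (∀ {i j} → S i j ⇔ (Adj H i j × ¬ F i j))

  problem : ∀ {Hs} → Unique Hs → (∀ {H} → H ∈ Hs → Compatible H) → Problem edges Hs
  problem {Hs} Hs! compat = record
    { U-unique      = edges-unique
    ; xs-unique     = Hs!
    ; triangle-free = λ p q r → link-triangle-free (∈-edges⁻ p) (∈-edges⁻ q) (∈-edges⁻ r)
    ; separated     = λ A∈ B∈ h → Adj-ext (agree A∈ B∈ (Equivalence.to ∘ h)) (agree B∈ A∈ (Equivalence.from ∘ h))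
    ; independent   = ind
    ; maximal       = max
    }
    where
    H-sym : ∀ {H} → H ∈ Hs → Symmetric (Adj H)
    H-sym H∈ = proj₁ (proj₁ (proj₁ (compat H∈)))
    H-free : ∀ {H} → H ∈ Hs → TriangleFree (Adj H)
    H-free H∈ = proj₁ (proj₂ (proj₁ (compat H∈)))
    S⇒H : ∀ {H i j} → H ∈ Hs → S i j → Adj H i j
    S⇒H H∈ s = proj₁ (Equivalence.to (proj₂ (compat H∈)) s)
    H⇒S : ∀ {H i j} → H ∈ Hs → Adj H i j → ¬ F i j → S i j
    H⇒S H∈ h ¬f = Equivalence.from (proj₂ (compat H∈)) (h , ¬f)
    -- An edge of H in F is eligible, since two edges of S closing a triangle with it would lie in H
    -- as well.
    H-edge : ∀ {H a b} → H ∈ Hs → Adj H a b → F a b → ∃[ e ] (e ∈ edges × Ends e a b)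
    H-edge H∈ h f = edge f λ (w , aw , bw) → H-free H∈ (_ , _ , w , h , S⇒H H∈ bw , S⇒H H∈ aw)
    agree : ∀ {A B} → A ∈ Hs → B ∈ Hs → (∀ {e} → e ∈ edges → Mem A e → Mem B e) →
            ∀ {i j} → Adj A i j → Adj B i j
    agree A∈ B∈ h {i} {j} Aij with F? i j
    ... | no ¬f = S⇒H B∈ (H⇒S A∈ Aij ¬f)
    ... | yes f with e , e∈ , ends ← H-edge A∈ Aij f =
      Ends-rel (H-sym B∈) ends (h e∈ (Ends-rel⁻ (H-sym A∈) ends Aij))
    ind : ∀ {H e f} → H ∈ Hs → e ∈ edges → f ∈ edges → Mem H e → Mem H f → ¬ Link e f
    ind H∈ _ _ He Hf (x , y , z , exy , fxz , yz) =
      H-free H∈ (_ , _ , _ , Ends-rel (H-sym H∈) exy He , S⇒H H∈ yz , Ends-rel (H-sym H∈) fxz Hf)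
    -- The blocker comes from the common neighbour `w`: uw and vw are not both in F because uv is,
    -- and not both in S because uv is eligible. The one in F is the blocker, the one in S makes the
    -- link.
    max : ∀ {H e} → H ∈ Hs → e ∈ edges → ¬ Mem H e → ∃[ f ] (f ∈ edges × Mem H f × Link e f)
    max {e = u , v} H∈ e∈ ¬He with ∈-edges⁻ e∈
    ... | (u<v , Fuv) , no-w
      with w , uw , vw ← common-neighbour (H-sym H∈) (H-free H∈) (Fin.<⇒≢ u<v)
                           (proj₂ (proj₂ (proj₁ (compat H∈))) u v (Fin.<⇒≢ u<v) ¬He)
      with F? u w | F? v w
    ...   | yes f | yes g = contradiction (_ , _ , _ , Fuv , g , f) F-free
    ...   | no ¬f | no ¬g = contradiction (w , H⇒S H∈ uw ¬f , H⇒S H∈ vw ¬g) no-w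
    ...   | yes f | no ¬g with e′ , e′∈ , ends ← H-edge H∈ uw f =
      e′ , e′∈ , Ends-rel⁻ (H-sym H∈) ends uw , u , v , w , inj₁ (refl , refl) , ends , H⇒S H∈ vw ¬g
    ...   | no ¬f | yes g with e′ , e′∈ , ends ← H-edge H∈ vw g =
      e′ , e′∈ , Ends-rel⁻ (H-sym H∈) ends vw , v , u , w , inj₂ (refl , refl) , ends , H⇒S H∈ uw ¬f

  few-compatible : ∀ {Hs} → Unique Hs → (∀ {H} → H ∈ Hs → Compatible H) → 2 * length Hs ≤ G (length edges)
  few-compatible Hs! compat = bounded (problem Hs! compat)

-- One-sided regularity

⟨_⟩ : Bool → ℕ
⟨ b ⟩ = if b then 1 else 0

sum-zero : ∀ {n} {f : Fin n → ℕ} → (∀ i → f i ≡ 0) → sum f ≡ 0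
sum-zero {n} h = trans (sum-cong-≗ h) (trans (sum-const n 0) (*-zeroʳ n))

ι : ∀ {n} → Subset n → Fin n → ℕ
ι X u = ⟨ lookup X u ⟩

subset : ∀ {n} {P : U.Pred (Fin n) 0ℓ} → U.Decidable P → Subset n
subset P? = Vec.tabulate (does ∘ P?)

ι-subset : ∀ {n} {P : U.Pred (Fin n) 0ℓ} (P? : U.Decidable P) u → ι (subset P?) u ≡ ⟦ P? u ⟧
ι-subset P? u = cong ⟨_⟩ (lookup∘tabulate (does ∘ P?) u)

ι-⊤ : ∀ {n} (u : Fin n) → ι Subset.⊤ u ≡ 1
ι-⊤ zero = refl
ι-⊤ (suc u) = ι-⊤ u

ι-⊥ : ∀ {n} (u : Fin n) → ι Subset.⊥ u ≡ 0
ι-⊥ zero = refl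
ι-⊥ (suc u) = ι-⊥ u

-- Splitting double sums along the classes of a partition

module Colouring {n M : ℕ} (p : Fin n → Fin M) where

  χ : Fin M → Fin n → ℕ
  χ i u = ⟦ p u Fin.≟ i ⟧

  χ-sum : ∀ u → sum (λ i → χ i u) ≡ 1
  χ-sum u = go (p u)
    where
    go : ∀ {m} (c : Fin m) → sum (λ i → ⟦ c Fin.≟ i ⟧) ≡ 1
    go {suc m} zero = cong suc (sum-zero {m} {λ _ → 0} λ _ → refl)
    go (suc c) = go c

  sum-by-colour : ∀ (f : Fin n → ℕ) → sum f ≡ sum λ i → sum λ u → χ i u * f u
  sum-by-colour f = begin
    sum f                                ≡⟨ sum-cong-≗ (λ u → sym (*-identityˡ (f u))) ⟩
    sum (λ u → 1 * f u)                  ≡⟨ sum-cong-≗ (λ u → cong (_* f u) (sym (χ-sum u))) ⟩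
    sum (λ u → sum (λ i → χ i u) * f u)  ≡⟨ sum-cong-≗ (λ u → *-distribʳ-sum (f u) (λ i → χ i u)) ⟩
    sum (λ u → sum (λ i → χ i u * f u))  ≡⟨ ∑-comm (λ u i → χ i u * f u) ⟩
    sum (λ i → sum (λ u → χ i u * f u))  ∎
    where open ≡-Reasoning

  cell : (i j : Fin M) → (Fin n → Fin n → ℕ) → ℕ
  cell i j f = ∑∑ λ u v → χ i u * (χ j v * f u v)

  ∑∑-by-cell : ∀ f → ∑∑ f ≡ sum λ i → sum λ j → cell i j f
  ∑∑-by-cell f = trans (sum-by-colour _) (sum-cong-≗ λ i → begin
    sum (λ u → χ i u * sum (f u))
      ≡⟨ sum-cong-≗ (λ u → cong (χ i u *_) (sum-by-colour (f u))) ⟩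
    sum (λ u → χ i u * sum (λ j → sum (λ v → χ j v * f u v)))
      ≡⟨ sum-cong-≗ (λ u → *-distribˡ-sum (χ i u) (λ j → sum (λ v → χ j v * f u v))) ⟩
    sum (λ u → sum (λ j → χ i u * sum (λ v → χ j v * f u v)))
      ≡⟨ sum-cong-≗ (λ u → sum-cong-≗ λ j → *-distribˡ-sum (χ i u) (λ v → χ j v * f u v)) ⟩
    sum (λ u → sum (λ j → sum (λ v → χ i u * (χ j v * f u v))))
      ≡⟨ ∑-comm (λ u j → sum (λ v → χ i u * (χ j v * f u v))) ⟩
    sum (λ j → cell i j f) ∎)
    where open ≡-Reasoning

  ∑∑-mono-cell : ∀ {f g} → (∀ i j → cell i j f ≤ cell i j g) → ∑∑ f ≤ ∑∑ g
  ∑∑-mono-cell {f} {g} h = subst₂ _≤_ (sym (∑∑-by-cell f)) (sym (∑∑-by-cell g))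
    (sum-mono λ i → sum-mono (h i))

  χ-cong : ∀ i j {f g : Fin n → Fin n → ℕ} → (∀ u v → p u ≡ i → p v ≡ j → f u v ≡ g u v) → cell i j f ≡ cell i j g
  χ-cong i j {f} {g} h = ∑∑-cong pointwise
    where
    pointwise : ∀ u v → χ i u * (χ j v * f u v) ≡ χ i u * (χ j v * g u v)
    pointwise u v with p u Fin.≟ i | p v Fin.≟ j
    ... | no _ | _ = refl
    ... | yes _ | no _ = refl
    ... | yes a | yes b = cong (λ m → 1 * (1 * m)) (h u v a b)

  cell-* : ∀ i j c f → cell i j (λ u v → c * f u v) ≡ c * cell i j f
  cell-* i j c f = trans (∑∑-cong λ u v → swap c (χ i u) (χ j v) (f u v)) (sym (∑∑-distribˡ c (λ u v → χ i u * (χ j v * f u v))))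
    where
    swap : ∀ c a b x → a * (b * (c * x)) ≡ c * (a * (b * x))
    swap = solve-∀

  size : Fin M → Subset n → ℕ
  size i X = sum λ u → χ i u * ι X u

  vol : Fin M → ℕ
  vol i = size i Subset.⊤

  cell-product : ∀ i j X Y → cell i j (λ u v → ι X u * ι Y v) ≡ size i X * size j Y
  cell-product i j X Y = sym (begin
    size i X * size j Y
      ≡⟨ *-distribʳ-sum (size j Y) (λ u → χ i u * ι X u) ⟩
    sum (λ u → χ i u * ι X u * size j Y)
      ≡⟨ sum-cong-≗ (λ u → *-distribˡ-sum (χ i u * ι X u) (λ v → χ j v * ι Y v)) ⟩
    ∑∑ (λ u v → χ i u * ι X u * (χ j v * ι Y v))
      ≡⟨ ∑∑-cong (λ u v → swap (χ i u) (ι X u) (χ j v) (ι Y v)) ⟩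
    cell i j (λ u v → ι X u * ι Y v) ∎)
    where
    open ≡-Reasoning
    swap : ∀ a x b y → a * x * (b * y) ≡ a * (b * (x * y))
    swap = solve-∀

-- Refining partitions by Boolean labels

module _ (M L : ℕ) where

  base : Fin (M * 2 ^ L) → Fin M
  base c = proj₁ (remQuot {M} (2 ^ L) c)

  bit : Fin (M * 2 ^ L) → Fin L → Bool
  bit c l = Inverse.to Fin.2↔Bool (finToFun {2} {L} (proj₂ (remQuot {M} (2 ^ L) c)) l)

module _ {n M L : ℕ} (p : Fin n → Fin M) (b : Fin L → Fin n → Bool) where

  refine : Fin n → Fin (M * 2 ^ L)
  refine v = combine (p v) (funToFin λ l → Inverse.from Fin.2↔Bool (b l v))

  base-refine : ∀ v → base M L (refine v) ≡ p v
  base-refine v = cong proj₁ (Fin.remQuot-combine {M} {2 ^ L} (p v) (funToFin λ l → Inverse.from Fin.2↔Bool (b l v)))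

  bit-refine : ∀ v l → bit M L (refine v) l ≡ b l v
  bit-refine v l =
    trans (cong (λ c → Inverse.to Fin.2↔Bool (finToFun {2} {L} (proj₂ c) l))
            (Fin.remQuot-combine {M} {2 ^ L} (p v) (funToFin λ l → Inverse.from Fin.2↔Bool (b l v))))
      (trans (cong (Inverse.to Fin.2↔Bool) (Fin.finToFun-funToFin (λ l → Inverse.from Fin.2↔Bool (b l v)) l)) (Inverse.strictlyInverseˡ Fin.2↔Bool (b l v)))

-- Each ordered pair of classes contributes one subset on its left and one on its right, so a vertex
-- records its class and `M * M` bits of either kind.
refined : ℕ → ℕ
refined M = M * 2 ^ (M * M) * 2 ^ (M * M)

module Refinement {n M : ℕ} (p : Fin n → Fin M) (X Y : Fin M → Fin M → Fin n → Bool) where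

  opaque
    at-pair : (Fin M → Fin M → Fin n → Bool) → Fin (M * M) → Fin n → Bool
    at-pair Z l v = Z (proj₁ (remQuot {M} M l)) (proj₂ (remQuot {M} M l)) v

    at-combine : ∀ Z i j v → at-pair Z (combine i j) v ≡ Z i j v
    at-combine Z i j v = cong (λ (c : Fin M × Fin M) → Z (proj₁ c) (proj₂ c) v) (Fin.remQuot-combine {M} {M} i j)

    p₁ : Fin n → Fin (M * 2 ^ (M * M))
    p₁ = refine p (at-pair X)

    p₂ : Fin n → Fin (refined M)
    p₂ = refine p₁ (at-pair Y)

    base₁ : Fin (refined M) → Fin (M * 2 ^ (M * M))
    base₁ = base (M * 2 ^ (M * M)) (M * M)

    base₁-p₂ : ∀ v → base₁ (p₂ v) ≡ p₁ v
    base₁-p₂ = base-refine p₁ (at-pair Y)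

    colour : Fin (refined M) → Fin M
    colour c = base M (M * M) (base₁ c)

    xbit ybit : Fin (refined M) → Fin M → Fin M → Bool
    xbit c i j = bit M (M * M) (base₁ c) (combine i j)
    ybit c i j = bit (M * 2 ^ (M * M)) (M * M) c (combine i j)

    colour-p₂ : ∀ v → colour (p₂ v) ≡ p v
    colour-p₂ v = trans (cong (base M (M * M)) (base₁-p₂ v)) (base-refine p (at-pair X) v)

    xbit-p₂ : ∀ v i j → xbit (p₂ v) i j ≡ X i j v
    xbit-p₂ v i j = trans (cong (λ c → bit M (M * M) c (combine i j)) (base₁-p₂ v))
      (trans (bit-refine p (at-pair X) v (combine i j)) (at-combine X i j v))

    ybit-p₂ : ∀ v i j → ybit (p₂ v) i j ≡ Y i j v
    ybit-p₂ v i j = trans (bit-refine p₁ (at-pair Y) v (combine i j)) (at-combine Y i j v)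

grow : ℕ → ℕ → ℕ
grow zero    M = M
grow (suc t) M = grow t (refined M)

-- Such an `f` is given by a map to `M` classes and an `M` by `M` table; for bounded `M` this leaves
-- only 2 ^ O(n) possibilities.
Blowup : ∀ {n} → ℕ → (Fin n → Fin n → Bool) → Set
Blowup {n} M f = Σ[ p ∈ (Fin n → Fin M) ] Σ[ R ∈ (Fin M → Fin M → Bool) ] (∀ u v → f u v ≡ R (p u) (p v))

blowup-refined : ∀ {n M} {f : Fin n → Fin n → Bool} → Blowup M f → Blowup (refined M) f
blowup-refined {n} {M} (p , R , f≡) =
  p₂ , (λ c d → R (colour c) (colour d)) , λ u v → trans (f≡ u v) (sym (cong₂ R (colour-p₂ u) (colour-p₂ v)))
  where open Refinement {n} {M} p (λ _ _ _ → false) (λ _ _ _ → false)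

-- The iteration may stop early; padding the partition lets one list, for a single number of
-- classes, serve all graphs H.
blowup-grow : ∀ t {n M} {f : Fin n → Fin n → Bool} → Blowup M f → Blowup (grow t M) f
blowup-grow zero b = b
blowup-grow (suc t) b = blowup-grow t (blowup-refined b)

-- Regular pairs, dead pairs and the refinement iteration

module Regularity
  {n : ℕ} {H : Rel (Fin n) 0ℓ} (H? : Decidable H) (H-sym : Symmetric H) (H-free : TriangleFree H)
  (k : ℕ) (2≤k : 2 ≤ k) where

  h : Fin n → Fin n → ℕ
  h u v = ⟦ H? u v ⟧

  h-sym : ∀ u v → h u v ≡ h v u
  h-sym u v = ≤-antisym (⟦⟧-mono (H? u v) (H? v u) H-sym) (⟦⟧-mono (H? v u) (H? u v) H-sym)

  ≤k* : ∀ m → m ≤ k * m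
  ≤k* m = ≤-trans (≤-reflexive (sym (*-identityˡ m))) (*-monoˡ-≤ m (≤-trans (s≤s z≤n) 2≤k))

  module _ {M : ℕ} (p : Fin n → Fin M) where
    open Colouring p

    -- Only the lower half of ε-regularity is asked for: large subsets of the two parts span more than
    -- a 1/k fraction of the possible edges.
    Sparse : (i j : Fin M) → Subset n → Subset n → Set
    Sparse i j X Y = k * cell i j (λ u v → ι X u * ι Y v * h u v) ≤ size i X * size j Y

    -- Pairs of classes that are sparse throughout are included, as are pairs with an empty class.
    -- The complement consists of pairs that are dense between any two large subsets.
    Irregular : Fin M → Fin M → Set
    Irregular i j = ∃[ X ] ∃[ Y ] (vol i ≤ k * size i X × vol j ≤ k * size j Y × Sparse i j X Y)

    irregular? : Decidable Irregular
    irregular? i j = anySubset? λ X → anySubset? λ Y →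
      (vol i ≤? k * size i X) ×-dec (vol j ≤? k * size j Y) ×-dec
      (k * cell i j (λ u v → ι X u * ι Y v * h u v) ≤? size i X * size j Y)

    degree : Fin M → Fin n → ℕ
    degree j u = sum λ v → χ j v * h u v

    low? : ∀ j → U.Decidable (λ u → k * degree j u ≤ vol j)
    low? j u = k * degree j u ≤? vol j

    low : Fin M → Subset n
    low j = subset (low? j)

    low-sparse : ∀ i j → Sparse i j (low j) Subset.⊤
    low-sparse i j = begin
      k * cell i j (λ u v → ι (low j) u * ι Subset.⊤ v * h u v)
        ≡⟨ cong (k *_) (sum-cong-≗ λ u → trans (sum-cong-≗ λ v → move u v)
             (sym (*-distribˡ-sum (χ i u * ι (low j) u) (λ v → χ j v * h u v)))) ⟩
      k * sum (λ u → χ i u * ι (low j) u * degree j u)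
        ≡⟨ *-distribˡ-sum k (λ u → χ i u * ι (low j) u * degree j u) ⟩
      sum (λ u → k * (χ i u * ι (low j) u * degree j u))
        ≤⟨ sum-mono bound ⟩
      sum (λ u → χ i u * ι (low j) u * vol j)
        ≡⟨ sym (*-distribʳ-sum (vol j) (λ u → χ i u * ι (low j) u)) ⟩
      size i (low j) * vol j ∎
      where
      open ≤-Reasoning
      rearrange : ∀ a b x y → a * (b * (x * 1 * y)) ≡ a * x * (b * y)
      rearrange = solve-∀
      move : ∀ u v → χ i u * (χ j v * (ι (low j) u * ι Subset.⊤ v * h u v)) ≡ χ i u * ι (low j) u * (χ j v * h u v)
      move u v = trans (cong (λ t → χ i u * (χ j v * (ι (low j) u * t * h u v))) (ι-⊤ v))
        (rearrange (χ i u) (χ j v) (ι (low j) u) (h u v))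
      bound′ : ∀ a {P : Set} (P? : Dec P) d w → (P → k * d ≤ w) → k * (a * ⟦ P? ⟧ * d) ≤ a * ⟦ P? ⟧ * w
      bound′ a (yes pr) d w f = ≤-trans (≤-reflexive (eq k a d)) (≤-trans (*-monoʳ-≤ a (f pr))
        (≤-reflexive (cong (_* w) (sym (*-identityʳ a)))))
        where
        eq : ∀ k a d → k * (a * 1 * d) ≡ a * (k * d)
        eq = solve-∀
      bound′ a (no _) d w f rewrite *-zeroʳ a = ≤-reflexive (*-zeroʳ k)
      bound : ∀ u → k * (χ i u * ι (low j) u * degree j u) ≤ χ i u * ι (low j) u * vol j
      bound u rewrite ι-subset (low? j) u = bound′ (χ i u) (low? j u) (degree j u) (vol j) id

    -- Otherwise the vertices of low degree together with the whole other class would be a large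
    -- sparse pair.
    few-low : ∀ {i j} → ¬ Irregular i j → k * size i (low j) < vol i
    few-low {i} {j} reg = ≰⇒> λ le → reg (low j , Subset.⊤ , le , ≤k* (vol j) , low-sparse i j)

    -- Union bound: either set of low vertices fills less than 1/k, hence less than half, of class
    -- `i`, so they cannot cover it.
    good-vertex : ∀ {i j l} → ¬ Irregular i j → ¬ Irregular i l →
      ∃[ v ] (vol j < k * degree j v × vol l < k * degree l v)
    good-vertex {i} {j} {l} reg₁ reg₂
      with Fin.any? (λ v → ¬? (low? j v) ×-dec ¬? (low? l v))
    ... | yes (v , a , b) = v , ≰⇒> a , ≰⇒> b
    ... | no none = contradiction (begin-strict
      2 * vol i
        ≤⟨ *-monoˡ-≤ (vol i) 2≤k ⟩
      k * vol i
        ≤⟨ *-monoʳ-≤ k (≤-trans (sum-mono cover) (≤-reflexive (∑-distrib-+ (λ u → χ i u * ι (low j) u) _))) ⟩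
      k * (size i (low j) + size i (low l))
        ≡⟨ *-distribˡ-+ k (size i (low j)) _ ⟩
      k * size i (low j) + k * size i (low l)
        <⟨ +-mono-< (few-low reg₁) (few-low reg₂) ⟩
      vol i + vol i
        ≡⟨ cong (vol i +_) (sym (+-identityʳ (vol i))) ⟩
      2 * vol i ∎) (<-irrefl refl)
      where
      open ≤-Reasoning
      split : ∀ a {P Q : Set} (P? : Dec P) (Q? : Dec Q) → (¬ P → ¬ ¬ Q) → a * 1 ≤ a * ⟦ P? ⟧ + a * ⟦ Q? ⟧
      split a (yes _) _ f = m≤m+n _ _
      split a (no _) (yes _) f = m≤n+m _ (a * 0)
      split a (no ¬p) (no ¬q) f = contradiction ¬q (f ¬p)
      cover : ∀ u → χ i u * ι Subset.⊤ u ≤ χ i u * ι (low j) u + χ i u * ι (low l) u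
      cover u rewrite ι-⊤ u | ι-subset (low? j) u | ι-subset (low? l) u =
        split (χ i u) (low? j u) (low? l u) λ a b → none (u , a , b)

    -- A good vertex has a large neighbourhood in both `j` and `l`. As H is triangle-free there is
    -- no edge between the two parts, so they witness that the pair is irregular.
    regular-triangle-free : ∀ {i j l} → ¬ Irregular i j → ¬ Irregular i l → Irregular j l
    regular-triangle-free {i} {j} {l} reg₁ reg₂ with good-vertex reg₁ reg₂
    ... | v , dj , dl = N , N , large j dj , large l dl , ≤-trans (≤-reflexive
            (trans (cong (k *_) (sum-zero λ u → sum-zero λ w → none u w)) (*-zeroʳ k))) z≤n
      where
      N = subset (H? v)
      large : ∀ j → vol j < k * degree j v → vol j ≤ k * size j N
      large j lt = ≤-trans (<⇒≤ lt) (≤-reflexive (cong (k *_) (sum-cong-≗ λ u → cong (χ j u *_) (sym (ι-subset (H? v) u)))))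
      zero′ : ∀ {P Q R : Set} (P? : Dec P) (Q? : Dec Q) (R? : Dec R) → (P → R → ¬ Q) → ⟦ P? ⟧ * ⟦ Q? ⟧ * ⟦ R? ⟧ ≡ 0
      zero′ (no _) _ _ _ = refl
      zero′ (yes _) (no _) _ _ = refl
      zero′ (yes _) (yes _) (no _) _ = refl
      zero′ (yes a) (yes b) (yes c) f = contradiction b (f a c)
      none : ∀ u w → χ j u * (χ l w * (ι N u * ι N w * h u w)) ≡ 0
      none u w rewrite ι-subset (H? v) u | ι-subset (H? v) w
        | zero′ (H? v u) (H? v w) (H? u w) (λ a b c → H-free (v , u , w , a , b , c))
        | *-zeroʳ (χ l w) = *-zeroʳ (χ j u)

    module _ (dead : Fin M → Fin M → Bool) where

      D : Fin n → Fin n → ℕ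
      D u v = ⟨ dead (p u) (p v) ⟩

      -- With division and subtraction, `dead-large` says that the dead area is at least (k³ + 1 -
      -- fuel) n² / k³. This holds trivially at fuel k³ + 1, while at fuel 0 the area would exceed
      -- n².
      record Invariant (fuel : ℕ) : Set where
        field
          dead-sparse : k * ∑∑ (λ u v → D u v * h u v) ≤ ∑∑ D
          dead-large  : suc (k * (k * k)) * (n * n) ≤ fuel * (n * n) + k * (k * k) * ∑∑ D

      bad : Fin M → Fin M → Bool
      bad i j = not (dead i j) ∧ does (irregular? i j)

      B : Fin n → Fin n → ℕ
      B u v = ⟨ bad (p u) (p v) ⟩

      -- The rectangle to be declared dead inside the pair: an irregularity witness if the pair is
      -- bad, empty otherwise. `alive` keeps it disjoint from the area already dead; `large` gives
      -- it at least 1/k² of a bad pair.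
      record Kill (i j : Fin M) : Set where
        field
          X Y    : Subset n
          sparse : Sparse i j X Y
          alive  : dead i j ≡ true → ∀ u v → lookup X u ∧ lookup Y v ≡ false
          large  : ⟨ bad i j ⟩ * (vol i * vol j) ≤ k * k * (size i X * size j Y)

      kill : ∀ i j → Kill i j
      kill i j with bad i j in eq
      ... | false = record
        { X = Subset.⊥ ; Y = Subset.⊥
        ; sparse = ≤-trans (≤-reflexive (trans (cong (k *_) (sum-zero λ u → sum-zero λ v → empty u v)) (*-zeroʳ k))) z≤n
        ; alive = λ _ u v → cong (_∧ lookup Subset.⊥ v) (⊥-false u)
        ; large = subst (λ b → ⟨ b ⟩ * (vol i * vol j) ≤ k * k * (size i Subset.⊥ * size j Subset.⊥)) (sym eq) z≤n }
        where
        ⊥-false : ∀ {m} (u : Fin m) → lookup Subset.⊥ u ≡ false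
        ⊥-false zero = refl
        ⊥-false (suc u) = ⊥-false u
        empty : ∀ u v → χ i u * (χ j v * (ι Subset.⊥ u * ι Subset.⊥ v * h u v)) ≡ 0
        empty u v rewrite ι-⊥ u | *-zeroʳ (χ j v) = *-zeroʳ (χ i u)
      ... | true with dead i j in deq | irregular? i j in ieq
      ...   | false | yes (X , Y , x , y , s) = record
        { X = X ; Y = Y ; sparse = s ; alive = λ q → case trans (sym deq) q of λ ()
        ; large = subst (λ b → ⟨ b ⟩ * (vol i * vol j) ≤ k * k * (size i X * size j Y))
                    (sym (cong₂ (λ a d → not a ∧ does d) deq ieq))
                    (≤-trans (≤-reflexive (*-identityˡ _)) (≤-trans (*-mono-≤ x y) (≤-reflexive (sq k (size i X) (size j Y))))) }
        where
        sq : ∀ k a b → k * a * (k * b) ≡ k * k * (a * b)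
        sq = solve-∀

      -- After splitting the classes by all `X` and `Y`, every rectangle is a union of pairs of new
      -- classes and can be declared dead. Bad pairs cover at least n² / k and each rectangle takes
      -- at least 1/k² of its pair, so the dead area grows by n² / k³, which pays for one unit of
      -- fuel.
      refinement-step : ∀ {fuel} → n * n ≤ k * ∑∑ B → Invariant (suc fuel) →
        Σ[ q ∈ (Fin n → Fin (refined M)) ] ∃[ dead′ ] (
          k * ∑∑ (λ u v → ⟨ dead′ (q u) (q v) ⟩ * h u v) ≤ ∑∑ (λ u v → ⟨ dead′ (q u) (q v) ⟩) ×
          suc (k * (k * k)) * (n * n) ≤ fuel * (n * n) + k * (k * k) * ∑∑ (λ u v → ⟨ dead′ (q u) (q v) ⟩))
      refinement-step {fuel} many inv = p₂ , dead′ , sparse′ , large′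
        where
        open Invariant inv
        open ≤-Reasoning
        X Y : Fin M → Fin M → Fin n → Bool
        X i j = lookup (Kill.X (kill i j))
        Y i j = lookup (Kill.Y (kill i j))
        open Refinement p X Y
        -- The old class and the labels are recovered from the new class: the `X` label of the first
        -- vertex and the `Y` label of the second.
        dead′ : Fin (refined M) → Fin (refined M) → Bool
        dead′ c d = dead (colour c) (colour d) ∨
          (xbit c (colour c) (colour d) ∧ ybit d (colour c) (colour d))
        N D′ : Fin n → Fin n → ℕ
        N u v = ⟨ X (p u) (p v) u ⟩ * ⟨ Y (p u) (p v) v ⟩
        D′ u v = ⟨ dead′ (p₂ u) (p₂ v) ⟩
        -- The new rectangle is disjoint from the old dead area, so the indicator of the union is a
        -- sum.
        bits : ∀ a x y → (a ≡ true → x ∧ y ≡ false) → ⟨ a ∨ (x ∧ y) ⟩ ≡ ⟨ a ⟩ + ⟨ x ⟩ * ⟨ y ⟩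
        bits false false _ _ = refl
        bits false true false _ = refl
        bits false true true _ = refl
        bits true false _ _ = refl
        bits true true false _ = refl
        bits true true true f = case f refl of λ ()
        D′≡ : ∀ u v → D′ u v ≡ D u v + N u v
        D′≡ u v rewrite colour-p₂ u | colour-p₂ v | xbit-p₂ u (p u) (p v) | ybit-p₂ v (p u) (p v) =
          bits (dead (p u) (p v)) (X (p u) (p v) u) (Y (p u) (p v) v) λ d → Kill.alive (kill (p u) (p v)) d u v
        ∑∑D′ : ∑∑ D′ ≡ ∑∑ D + ∑∑ N
        ∑∑D′ = trans (∑∑-cong D′≡) (∑∑-distrib-+ D N)
        cell-N : ∀ i j → cell i j N ≡ size i (Kill.X (kill i j)) * size j (Kill.Y (kill i j))
        cell-N i j = trans (χ-cong i j λ { u v refl refl → refl }) (cell-product i j (Kill.X (kill i j)) (Kill.Y (kill i j)))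
        sparse-N : k * ∑∑ (λ u v → N u v * h u v) ≤ ∑∑ N
        sparse-N = ≤-trans (≤-reflexive (∑∑-distribˡ k (λ u v → N u v * h u v))) (∑∑-mono-cell λ i j → begin
          cell i j (λ u v → k * (N u v * h u v))
            ≡⟨ cell-* i j k (λ u v → N u v * h u v) ⟩
          k * cell i j (λ u v → N u v * h u v)
            ≡⟨ cong (k *_) (χ-cong i j λ { u v refl refl → refl }) ⟩
          k * cell i j (λ u v → ι (Kill.X (kill i j)) u * ι (Kill.Y (kill i j)) v * h u v)
            ≤⟨ Kill.sparse (kill i j) ⟩
          size i (Kill.X (kill i j)) * size j (Kill.Y (kill i j))
            ≡⟨ sym (cell-N i j) ⟩
          cell i j N ∎)
        large-N : ∑∑ B ≤ k * k * ∑∑ N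
        large-N = ≤-trans (∑∑-mono-cell {B} {λ u v → k * k * N u v} λ i j → begin
          cell i j B
            ≡⟨ χ-cong i j (λ { u v refl refl → sym (trans (cong (⟨ bad (p u) (p v) ⟩ *_)
                 (cong₂ _*_ (ι-⊤ u) (ι-⊤ v))) (*-identityʳ _)) }) ⟩
          cell i j (λ u v → ⟨ bad i j ⟩ * (ι Subset.⊤ u * ι Subset.⊤ v))
            ≡⟨ cell-* i j ⟨ bad i j ⟩ (λ u v → ι Subset.⊤ u * ι Subset.⊤ v) ⟩
          ⟨ bad i j ⟩ * cell i j (λ u v → ι Subset.⊤ u * ι Subset.⊤ v)
            ≡⟨ cong (⟨ bad i j ⟩ *_) (cell-product i j Subset.⊤ Subset.⊤) ⟩
          ⟨ bad i j ⟩ * (vol i * vol j)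
            ≤⟨ Kill.large (kill i j) ⟩
          k * k * (size i (Kill.X (kill i j)) * size j (Kill.Y (kill i j)))
            ≡⟨ cong (k * k *_) (sym (cell-N i j)) ⟩
          k * k * cell i j N
            ≡⟨ sym (cell-* i j (k * k) N) ⟩
          cell i j (λ u v → k * k * N u v) ∎) (≤-reflexive (sym (∑∑-distribˡ (k * k) N)))
        sparse′ : k * ∑∑ (λ u v → D′ u v * h u v) ≤ ∑∑ D′
        sparse′ = begin
          k * ∑∑ (λ u v → D′ u v * h u v)
            ≡⟨ cong (k *_) (∑∑-cong λ u v → trans (cong (_* h u v) (D′≡ u v)) (*-distribʳ-+ (h u v) (D u v) (N u v))) ⟩
          k * ∑∑ (λ u v → D u v * h u v + N u v * h u v)
            ≡⟨ cong (k *_) (∑∑-distrib-+ (λ u v → D u v * h u v) (λ u v → N u v * h u v)) ⟩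
          k * (∑∑ (λ u v → D u v * h u v) + ∑∑ (λ u v → N u v * h u v))
            ≡⟨ *-distribˡ-+ k (∑∑ (λ u v → D u v * h u v)) _ ⟩
          k * ∑∑ (λ u v → D u v * h u v) + k * ∑∑ (λ u v → N u v * h u v)
            ≤⟨ +-mono-≤ dead-sparse sparse-N ⟩
          ∑∑ D + ∑∑ N
            ≡⟨ sym ∑∑D′ ⟩
          ∑∑ D′ ∎
        large′ : suc (k * (k * k)) * (n * n) ≤ fuel * (n * n) + k * (k * k) * ∑∑ D′
        large′ = begin
          suc (k * (k * k)) * (n * n)
            ≤⟨ dead-large ⟩
          n * n + fuel * (n * n) + k * (k * k) * ∑∑ D
            ≤⟨ +-monoˡ-≤ (k * (k * k) * ∑∑ D) (+-monoˡ-≤ (fuel * (n * n)) (≤-trans many (*-monoʳ-≤ k large-N))) ⟩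
          k * (k * k * ∑∑ N) + fuel * (n * n) + k * (k * k) * ∑∑ D
            ≡⟨ rearrange k (∑∑ N) (fuel * (n * n)) (∑∑ D) ⟩
          fuel * (n * n) + k * (k * k) * (∑∑ D + ∑∑ N)
            ≡⟨ cong (λ m → fuel * (n * n) + k * (k * k) * m) (sym ∑∑D′) ⟩
          fuel * (n * n) + k * (k * k) * ∑∑ D′ ∎
          where
          rearrange : ∀ k a f d → k * (k * k * a) + f + k * (k * k) * d ≡ f + k * (k * k) * (d + a)
          rearrange = solve-∀

      ∑∑D≤ : ∑∑ D ≤ n * n
      ∑∑D≤ = ≤-trans (∑∑-mono {f = D} {λ _ _ → 1} λ u v → ⟨⟩≤1 (dead (p u) (p v)))
        (≤-reflexive (trans (∑∑-const n 1) (*-identityʳ _)))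
        where
        ⟨⟩≤1 : ∀ b → ⟨ b ⟩ ≤ 1
        ⟨⟩≤1 false = z≤n
        ⟨⟩≤1 true = ≤-refl

      alive-regular : Fin M → Fin M → Bool
      alive-regular i j = not (dead i j) ∧ not (does (irregular? i j))

      -- `dead` is not kept symmetric, since a witness (`X`, `Y`) is killed in one order only; both
      -- orders are tested here instead.
      reduced : Fin M → Fin M → Bool
      reduced i j = alive-regular i j ∧ alive-regular j i

      reduced-sym : ∀ i j → reduced i j ≡ reduced j i
      reduced-sym i j = Bool.∧-comm (alive-regular i j) (alive-regular j i)

      reduced⇒regular : ∀ {i j} → reduced i j ≡ true → ¬ Irregular i j
      reduced⇒regular {i} {j} r irr with dead i j | irregular? i j
      ... | true | _ = case r of λ ()
      ... | false | yes _ = case r of λ ()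
      ... | false | no ¬irr = ¬irr irr

      reduced-triangle-free : ∀ {i j l} → reduced i j ≡ true → reduced j l ≡ true → reduced i l ≡ true → ⊥
      reduced-triangle-free ij jl il =
        reduced⇒regular jl (regular-triangle-free (reduced⇒regular ij) (reduced⇒regular il))

      -- Edges in dead pairs number at most n² / k because these pairs are sparse, those in bad
      -- pairs at most n² / k because these have small area. Testing both orders in `reduced`
      -- doubles the sum, whence the 4.
      lost : ∀ {fuel} → k * ∑∑ B ≤ n * n → Invariant fuel →
        k * ∑∑ (λ u v → ⟨ not (reduced (p u) (p v)) ⟩ * h u v) ≤ 4 * (n * n)
      lost few inv = begin
        k * ∑∑ (λ u v → ⟨ not (reduced (p u) (p v)) ⟩ * h u v)
          ≤⟨ *-monoʳ-≤ k (∑∑-mono cover) ⟩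
        k * ∑∑ (λ u v → E u v + E v u)
          ≡⟨ cong (k *_) (trans (∑∑-distrib-+ E (λ u v → E v u)) (cong (∑∑ E +_) (sym (∑∑-transpose E)))) ⟩
        k * (∑∑ E + ∑∑ E)
          ≡⟨ *-distribˡ-+ k (∑∑ E) (∑∑ E) ⟩
        k * ∑∑ E + k * ∑∑ E
          ≤⟨ +-mono-≤ half half ⟩
        n * n + n * n + (n * n + n * n)
          ≡⟨ four (n * n) ⟩
        4 * (n * n) ∎
        where
        open ≤-Reasoning
        open Invariant inv
        E : Fin n → Fin n → ℕ
        E u v = D u v * h u v + B u v
        four : ∀ m → m + m + (m + m) ≡ 4 * m
        four = solve-∀
        half : k * ∑∑ E ≤ n * n + n * n
        half = begin
          k * ∑∑ E
            ≡⟨ cong (k *_) (∑∑-distrib-+ (λ u v → D u v * h u v) B) ⟩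
          k * (∑∑ (λ u v → D u v * h u v) + ∑∑ B)
            ≡⟨ *-distribˡ-+ k _ (∑∑ B) ⟩
          k * ∑∑ (λ u v → D u v * h u v) + k * ∑∑ B
            ≤⟨ +-mono-≤ (≤-trans dead-sparse ∑∑D≤) few ⟩
          n * n + n * n ∎
        cases : ∀ d i d′ i′ {x} → x ≤ 1 →
          ⟨ not ((not d ∧ not i) ∧ (not d′ ∧ not i′)) ⟩ * x
            ≤ ⟨ d ⟩ * x + ⟨ not d ∧ i ⟩ + (⟨ d′ ⟩ * x + ⟨ not d′ ∧ i′ ⟩)
        cases true i d′ i′ {x} _ = ≤-trans (m≤m+n (1 * x) 0) (m≤m+n (1 * x + 0) _)
        cases false true d′ i′ {x} x≤1 = ≤-trans (≤-trans (≤-reflexive (*-identityˡ x)) x≤1) (s≤s z≤n)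
        cases false false true i′ {x} _ = m≤m+n (1 * x) 0
        cases false false false true {x} x≤1 = ≤-trans (≤-reflexive (*-identityˡ x)) x≤1
        cases false false false false _ = z≤n
        cover : ∀ u v → ⟨ not (reduced (p u) (p v)) ⟩ * h u v ≤ E u v + E v u
        cover u v rewrite h-sym v u = cases (dead (p u) (p v)) (does (irregular? (p u) (p v)))
          (dead (p v) (p u)) (does (irregular? (p v) (p u))) (⟦⟧≤1 (H? u v))

  record Approximation (M : ℕ) : Set where
    field
      f             : Fin n → Fin n → Bool
      blowup        : Blowup M f
      f-sym         : ∀ u v → f u v ≡ f v u
      f-free        : TriangleFree (λ u v → f u v ≡ true)
      few-uncovered : k * ∑∑ (λ u v → ⟨ not (f u v) ⟩ * h u v) ≤ 4 * (n * n)

  -- Either the bad area is at least n² / k and a refinement uses up fuel, or it is at most that and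
  -- the current partition is good enough. Running out of fuel is impossible, as the dead area would
  -- be more than n².
  approximate′ : 0 < n → ∀ fuel {M} (p : Fin n → Fin M) (dead : Fin M → Fin M → Bool) →
    Invariant p dead fuel → Approximation (grow fuel M)
  approximate′ 0<n zero {M} p dead inv = contradiction impossible (<⇒≱ (m<n+m (k * (k * k) * (n * n)) (*-mono-≤ 0<n 0<n)))
    where
    impossible : n * n + k * (k * k) * (n * n) ≤ k * (k * k) * (n * n)
    impossible = ≤-trans (Invariant.dead-large inv) (*-monoʳ-≤ (k * (k * k)) (∑∑D≤ p dead))
  approximate′ 0<n (suc fuel) {M} p dead inv = [ continue , stop ]′ (≤-total (n * n) (k * ∑∑ (B p dead)))
    where
    continue : n * n ≤ k * ∑∑ (B p dead) → Approximation (grow fuel (refined M))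
    continue many =
      let q , dead′ , s , l = refinement-step p dead many inv
      in approximate′ 0<n fuel q dead′ (record { dead-sparse = s ; dead-large = l })
    stop : k * ∑∑ (B p dead) ≤ n * n → Approximation (grow (suc fuel) M)
    stop few = record
      { f = λ u v → reduced p dead (p u) (p v)
      ; blowup = blowup-grow (suc fuel) {n} {M} (p , reduced p dead , λ _ _ → refl)
      ; f-sym = λ u v → reduced-sym p dead (p u) (p v)
      ; f-free = λ (_ , _ , _ , ij , jk , ik) → reduced-triangle-free p dead ij jk ik
      ; few-uncovered = lost p dead few inv
      }

  approximate : 0 < n → Approximation (grow (suc (k * (k * k))) 1)
  approximate 0<n = approximate′ 0<n (suc (k * (k * k))) none all-alive (record
    { dead-sparse = ≤-reflexive (trans (cong (k *_) (sum-zero {n} λ u → sum-zero {n} {λ _ → 0} λ _ → refl))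
        (trans (*-zeroʳ k) (sym (sum-zero {n} λ u → sum-zero {n} {λ _ → 0} λ _ → refl))))
    ; dead-large = m≤m+n (suc (k * (k * k)) * (n * n)) (k * (k * k) * ∑∑ (D none all-alive)) })
    where
    none : Fin n → Fin 1
    none _ = zero
    all-alive : Fin 1 → Fin 1 → Bool
    all-alive _ _ = false

-- Counting codes

length-fibres : ∀ {X Y : Set} (_≟_ : DecidableEquality Y) (code : X → Y) {b} ys {xs} → Unique xs →
  (∀ {x} → x ∈ xs → code x ∈ ys) →
  (∀ {y zs} → Unique zs → (∀ {x} → x ∈ zs → x ∈ xs × code x ≡ y) → length zs ≤ b) →
  length xs ≤ length ys * b
length-fibres _≟_ code [] {[]} _ _ _ = z≤n
length-fibres _≟_ code [] {x ∷ xs} _ covered _ = case covered (here refl) of λ ()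
length-fibres {X} _≟_ code {b} (y ∷ ys) {xs} xs! covered fibre = ≤-trans
  (≤-reflexive (length-filter-split (λ x → code x ≟ y) xs))
  (+-mono-≤ (fibre (Unique.filter⁺ (λ x → code x ≟ y) xs!) (∈-filter⁻ (λ x → code x ≟ y)))
    (length-fibres _≟_ code ys (Unique.filter⁺ y≢? xs!) covered′
      λ zs! h → fibre zs! λ z∈ → proj₁ (∈-filter⁻ y≢? {xs = xs} (proj₁ (h z∈))) , proj₂ (h z∈)))
  where
  y≢? = λ (x : X) → ¬? (code x ≟ y)
  covered′ : ∀ {x} → x ∈ filter y≢? xs → code x ∈ ys
  covered′ x∈ with x∈xs , x≢y ← ∈-filter⁻ y≢? {xs = xs} x∈ with covered x∈xs
  ... | here eq = contradiction eq x≢y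
  ... | there c∈ = c∈

length-cartesianProductWith : ∀ {A B C : Set} (f : A → B → C) xs ys →
  length (cartesianProductWith f xs ys) ≡ length xs * length ys
length-cartesianProductWith f [] ys = refl
length-cartesianProductWith f (x ∷ xs) ys = trans (length-++ (map (f x) ys))
  (cong₂ _+_ (length-map (f x) ys) (length-cartesianProductWith f xs ys))

length-allVecs : ∀ {X : Set} (xs : List X) k → length (allVecs xs k) ≡ length xs ^ k
length-allVecs xs zero = refl
length-allVecs xs (suc k) = trans (length-cartesianProductWith _∷_ xs (allVecs xs k))
  (cong (length xs *_) (length-allVecs xs k))

-- Weights on lists and the number of sparse matrices

module _ {X : Set} (w : X → ℕ) where

  weight : List X → ℕ
  weight xs = ListAction.sum (map w xs)

  weightVec : ∀ {k} → Vec X k → ℕ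
  weightVec [] = 1
  weightVec (x ∷ v) = w x * weightVec v

weight-map-* : ∀ {X Y : Set} (w : X → ℕ) (w′ : Y → ℕ) (f : X → Y) c → (∀ x → w′ (f x) ≡ c * w x) →
               ∀ xs → weight w′ (map f xs) ≡ c * weight w xs
weight-map-* w w′ f c h [] = sym (*-zeroʳ c)
weight-map-* w w′ f c h (x ∷ xs) =
  trans (cong₂ _+_ (h x) (weight-map-* w w′ f c h xs)) (sym (*-distribˡ-+ c (w x) (weight w xs)))

weight-++ : ∀ {X : Set} (w : X → ℕ) xs ys → weight w (xs ++ ys) ≡ weight w xs + weight w ys
weight-++ w xs ys = trans (cong ListAction.sum (map-++ w xs ys)) (sum-++ (map w xs) (map w ys))

weight-allVecs : ∀ {X : Set} (w : X → ℕ) xs k → weight (weightVec w) (allVecs xs k) ≡ weight w xs ^ k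
weight-allVecs w xs zero = refl
weight-allVecs w xs (suc k) = trans (go xs) (cong (weight w xs *_) (weight-allVecs w xs k))
  where
  vs = allVecs xs k
  go : ∀ ys → weight (weightVec w) (cartesianProductWith _∷_ ys vs) ≡ weight w ys * weight (weightVec w) vs
  go [] = refl
  go (y ∷ ys) = trans (weight-++ (weightVec w) (map (y ∷_) vs) (cartesianProductWith _∷_ ys vs))
    (trans (cong₂ _+_ (weight-map-* (weightVec w) (weightVec w) (y ∷_) (w y) (λ _ → refl) vs) (go ys))
      (sym (*-distribʳ-+ (weight (weightVec w) vs) (w y) (weight w ys))))

-- Markov's inequality: every selected element weighs at least c / a.
weight-filter : ∀ {X : Set} (w : X → ℕ) {P : X → Set} (P? : ∀ x → Dec (P x)) {a c} → (∀ {x} → P x → c ≤ w x * a) →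
  ∀ xs → length (filter P? xs) * c ≤ weight w xs * a
weight-filter w P? h [] = z≤n
weight-filter w P? {a} h (x ∷ xs) with P? x
... | yes p = ≤-trans (+-mono-≤ (h p) (weight-filter w P? h xs)) (≤-reflexive (sym (*-distribʳ-+ a (w x) _)))
... | no _ = ≤-trans (weight-filter w P? h xs) (*-monoˡ-≤ a (m≤n+m _ (w x)))

trues : ∀ {n} → AdjacencyMatrix n → ℕ
trues A = ∑∑ λ u v → ⟨ lookup (lookup A u) v ⟩

module _ (t : ℕ) .{{_ : NonZero t}} where

  -- Weighting a 0/1 matrix by t to the number of its zeros gives total weight (t + 1) ^ (n * n),
  -- while each matrix with few ones is heavy.
  bitWeight : Bool → ℕ
  bitWeight b = if b then 1 else t

  bitWeight-* : ∀ b → bitWeight b * t ^ ⟨ b ⟩ ≡ t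
  bitWeight-* true = trans (*-identityˡ _) (*-identityʳ t)
  bitWeight-* false = *-identityʳ t

  -- Used at two levels: for rows with entry constant `t`, then for matrices with row constant
  -- `t ^ n`.
  weightVec-* : ∀ {X : Set} (w count : X → ℕ) c → (∀ x → w x * t ^ count x ≡ c) →
    ∀ {m} (v : Vec X m) → weightVec w v * t ^ sum (λ i → count (lookup v i)) ≡ c ^ m
  weightVec-* w count c h [] = refl
  weightVec-* w count c h {suc m} (x ∷ v) = begin
    w x * weightVec w v * t ^ (count x + s)         ≡⟨ cong (w x * weightVec w v *_) (^-distribˡ-+-* t (count x) s) ⟩
    w x * weightVec w v * (t ^ count x * t ^ s)     ≡⟨ swap (w x) (weightVec w v) (t ^ count x) (t ^ s) ⟩
    w x * t ^ count x * (weightVec w v * t ^ s)     ≡⟨ cong₂ _*_ (h x) (weightVec-* w count c h v) ⟩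
    c * c ^ m                                       ∎
    where
    open ≡-Reasoning
    s = sum (λ i → count (lookup v i))
    swap : ∀ a b c d → a * b * (c * d) ≡ a * c * (b * d)
    swap = solve-∀

  sparse? : ∀ {n} s (A : AdjacencyMatrix n) → Dec (trues A ≤ s)
  sparse? s A = trues A ≤? s

  -- Exponential-moment estimate: a matrix with at most `s` ones weighs at least t ^ (n² - s), and
  -- the total weight is (1 + t) ^ n².
  few-sparse : ∀ n s → length (filter (sparse? s) (allMatrices n)) * (t ^ n) ^ n ≤ ((1 + t) ^ n) ^ n * t ^ s
  few-sparse n s = ≤-trans
    (weight-filter matrixWeight (sparse? s) (λ {A} → heavy {A}) (allMatrices n))
    (≤-reflexive (cong (_* t ^ s) total))
    where
    matrixWeight : AdjacencyMatrix n → ℕ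
    matrixWeight = weightVec (weightVec bitWeight)
    total : weight matrixWeight (allMatrices n) ≡ ((1 + t) ^ n) ^ n
    total = trans (weight-allVecs (weightVec bitWeight) (allSubsets n) n)
      (cong (_^ n) (trans (weight-allVecs bitWeight (true ∷ false ∷ []) n) (cong (λ m → suc m ^ n) (+-identityʳ t))))
    heavy : ∀ {A} → trues A ≤ s → (t ^ n) ^ n ≤ matrixWeight A * t ^ s
    heavy {A} le = ≤-trans
      (≤-reflexive (sym (weightVec-* (weightVec bitWeight) (λ v → sum (λ j → ⟨ lookup v j ⟩)) (t ^ n)
        (weightVec-* bitWeight ⟨_⟩ t bitWeight-*) A)))
      (*-monoʳ-≤ (matrixWeight A) (^-monoʳ-≤ t le))

-- Encoding a graph by a container F and the remainder S

module Containers (n M : ℕ) where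

  matrix : (Fin n → Fin n → Bool) → AdjacencyMatrix n
  matrix f = Vec.tabulate λ u → Vec.tabulate (f u)

  lookup-matrix : ∀ f u v → lookup (lookup (matrix f) u) v ≡ f u v
  lookup-matrix f u v = trans (cong (λ r → lookup r v) (lookup∘tabulate (λ u → Vec.tabulate (f u)) u)) (lookup∘tabulate (f u) v)

  blowup : Vec (Fin M) n → AdjacencyMatrix M → AdjacencyMatrix n
  blowup p R = matrix λ u v → lookup (lookup R (lookup p u)) (lookup p v)

  containers : List (AdjacencyMatrix n)
  containers = cartesianProductWith blowup (allVecs (allFin M) n) (allMatrices M)

  length-containers : length containers ≡ M ^ n * (2 ^ M) ^ M
  length-containers = trans (length-cartesianProductWith blowup (allVecs (allFin M) n) (allMatrices M))
    (cong₂ _*_ (trans (length-allVecs (allFin M) n) (cong (_^ n) (length-tabulate {n = M} id)))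
      (trans (length-allVecs (allSubsets M) M) (cong (_^ M) (length-allVecs (true ∷ false ∷ []) M))))

  ∈-containers : ∀ {f} → Blowup M f → ∃[ A ] (A ∈ containers × (∀ u v → lookup (lookup A u) v ≡ f u v))
  ∈-containers {f} (p , R , f≡) =
    blowup pv Rv , ∈-cartesianProductWith⁺ blowup (∈-allVecs ∈-allFin pv) (∈-allVecs ∈-allSubsets Rv) ,
    λ u v → trans (lookup-matrix _ u v) (trans (entry (lookup pv u) (lookup pv v))
      (trans (cong₂ R (lookup∘tabulate p u) (lookup∘tabulate p v)) (sym (f≡ u v))))
    where
    pv = Vec.tabulate p
    Rv = Vec.tabulate λ i → Vec.tabulate (R i)
    entry : ∀ i j → lookup (lookup Rv i) j ≡ R i j
    entry i j = trans (cong (λ r → lookup r j) (lookup∘tabulate (λ i → Vec.tabulate (R i)) i)) (lookup∘tabulate (R i) j)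

module Count (n : ℕ) (0<n : 0 < n) (k : ℕ) (2≤k : 2 ≤ k) .{{_ : NonZero k}} (t : ℕ) .{{_ : NonZero t}} where

  M s : ℕ
  M = grow (suc (k * (k * k))) 1
  s = 4 * (n * n) / k

  open Containers n M

  sparse : List (AdjacencyMatrix n)
  sparse = filter (sparse? t s) (allMatrices n)

  Code : Set
  Code = AdjacencyMatrix n × AdjacencyMatrix n

  code-≟ : DecidableEquality Code
  code-≟ = Product.≡-dec matrix-≟ matrix-≟
    where
    matrix-≟ : DecidableEquality (AdjacencyMatrix n)
    matrix-≟ = Vec.≡-dec (Vec.≡-dec Bool._≟_)

  codes : List Code
  codes = cartesianProduct containers sparse

  record Encodes (H : AdjacencyMatrix n) (c : Code) : Set where
    field
      listed     : c ∈ codes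
      F-sym      : Symmetric (Adj (proj₁ c))
      F-free     : TriangleFree (Adj (proj₁ c))
      difference : ∀ {i j} → Adj (proj₂ c) i j ⇔ (Adj H i j × ¬ Adj (proj₁ c) i j)

  module _ (H : AdjacencyMatrix n) (H-sym : Symmetric (Adj H)) (H-free : TriangleFree (Adj H)) where
    open Regularity (adj? H) H-sym H-free k 2≤k

    encode-by : (a : Approximation M) → ∃[ A ] (A ∈ containers × (∀ u v → lookup (lookup A u) v ≡ Approximation.f a u v)) →
      ∃[ c ] Encodes H c
    encode-by approx (A , A∈ , A≡) = (A , S) , record
      { listed = ∈-cartesianProduct⁺ A∈ (∈-filter⁺ (sparse? t s) (∈-allVecs ∈-allSubsets S) S-sparse)
      ; F-sym = λ {u} {v} a → f⇒A (trans (f-sym v u) (A⇒f a))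
      ; F-free = λ (u , v , w , a , b , c) → f-free (u , v , w , A⇒f a , A⇒f b , A⇒f c)
      ; difference = mk⇔ to from }
      where
      open Approximation approx
      g : Fin n → Fin n → Bool
      g u v = does (adj? H u v) ∧ not (f u v)
      S = matrix g
      A⇒f : ∀ {u v} → Adj A u v → f u v ≡ true
      A⇒f {u} {v} a = trans (sym (A≡ u v)) ([]=⇒lookup a)
      f⇒A : ∀ {u v} → f u v ≡ true → Adj A u v
      f⇒A {u} {v} e = lookup⇒[]= v _ (trans (A≡ u v) e)
      ∧-* : ∀ a b → ⟨ a ∧ not b ⟩ ≡ ⟨ not b ⟩ * ⟨ a ⟩
      ∧-* false b = sym (*-zeroʳ ⟨ not b ⟩)
      ∧-* true b = sym (*-identityʳ ⟨ not b ⟩)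
      S-sparse : trues S ≤ s
      S-sparse = begin
        trues S          ≡⟨ sym (m*n/n≡m (trues S) k) ⟩
        trues S * k / k  ≤⟨ /-monoˡ-≤ k (≤-trans (≤-reflexive (trans (*-comm (trues S) k) (cong (k *_)
                              (∑∑-cong λ u v → trans (cong ⟨_⟩ (lookup-matrix g u v)) (∧-* (does (adj? H u v)) (f u v)))))) few-uncovered) ⟩
        s                ∎
        where open ≤-Reasoning
      from : ∀ {u v} → Adj H u v × ¬ Adj A u v → Adj S u v
      from {u} {v} (a , ¬b) = lookup⇒[]= v _ (trans (lookup-matrix g u v)
        (cong₂ _∧_ (dec-true (adj? H u v) a) (cong not (Bool.¬-not (¬b ∘ f⇒A)))))
      ∧-not : ∀ {P : Set} (P? : Dec P) {b} → does P? ∧ not b ≡ true → P × b ≢ true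
      ∧-not (yes p) {false} _ = p , λ ()
      to : ∀ {u v} → Adj S u v → Adj H u v × ¬ Adj A u v
      to {u} {v} a with h , ¬f ← ∧-not (adj? H u v) (trans (sym (lookup-matrix g u v)) ([]=⇒lookup a)) = h , ¬f ∘ A⇒f

  encode : ∀ H → IsMaximalTriangleFreeGraph H → ∃[ c ] Encodes H c
  encode H ((H-sym , _) , H-free , _) = encode-by H H-sym H-free approx (∈-containers (Regularity.Approximation.blowup approx))
    where approx = Regularity.approximate (adj? H) H-sym H-free k 2≤k 0<n

  codeBy : ∀ H → Dec (IsMaximalTriangleFreeGraph H) → Code
  codeBy H (yes m) = proj₁ (encode H m)
  -- Default value making `code` total; the list that is counted holds maximal graphs only.
  codeBy H (no _) = H , H

  codeBy-encodes : ∀ H (m? : Dec (IsMaximalTriangleFreeGraph H)) → IsMaximalTriangleFreeGraph H → Encodes H (codeBy H m?)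
  codeBy-encodes H (yes m) _ = proj₂ (encode H m)
  codeBy-encodes H (no ¬m) m = contradiction m ¬m

  code : AdjacencyMatrix n → Code
  code H = codeBy H (isMaximalTriangleFreeGraph? H)

  code-encodes : ∀ H → IsMaximalTriangleFreeGraph H → Encodes H (code H)
  code-encodes H m = codeBy-encodes H (isMaximalTriangleFreeGraph? H) m

  maximal⁻ : ∀ {H} → H ∈ maximalTriangleFreeGraphs n → IsMaximalTriangleFreeGraph H
  maximal⁻ H∈ = proj₂ (∈-filter⁻ isMaximalTriangleFreeGraph? {xs = allMatrices n} H∈)

  -- Symmetry and triangle-freeness of S are inherited from one member `H₀` of the fibre, so the
  -- empty fibre is treated apart.
  fibre-bound : ∀ {c Hs} → Unique Hs → (∀ {H} → H ∈ Hs → H ∈ maximalTriangleFreeGraphs n × code H ≡ c) →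
    length Hs ≤ G (n * n / 4)
  fibre-bound {Hs = []} _ _ = z≤n
  fibre-bound {c} {H₀ ∷ Hs} Hs! h = ≤-trans (m≤m+n _ _)
    (≤-trans (few-compatible Hs! compatible) (G-mono edges≤))
    where
    encodes : ∀ {H} → H ∈ H₀ ∷ Hs → Encodes H c
    encodes {H} H∈ = subst (Encodes H) (proj₂ (h H∈)) (code-encodes H (maximal⁻ (proj₁ (h H∈))))
    open Encodes (encodes (here refl))
    max₀ : IsMaximalTriangleFreeGraph H₀
    max₀ = maximal⁻ (proj₁ (h (here refl)))
    S-sym : Symmetric (Adj (proj₂ c))
    S-sym ij = let a , ¬b = Equivalence.to difference ij in
      Equivalence.from difference (proj₁ (proj₁ max₀) a , λ b → ¬b (F-sym b))
    S⇒H : ∀ {i j} → Adj (proj₂ c) i j → Adj H₀ i j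
    S⇒H ij = proj₁ (Equivalence.to difference ij)
    S-free : TriangleFree (Adj (proj₂ c))
    S-free (i , j , l , ij , jl , il) = proj₁ (proj₂ max₀) (i , j , l , S⇒H ij , S⇒H jl , S⇒H il)
    open LinkGraph (adj? (proj₁ c)) F-sym F-free (adj? (proj₂ c)) S-sym S-free
    compatible : ∀ {H} → H ∈ H₀ ∷ Hs → Compatible H
    compatible H∈ = maximal⁻ (proj₁ (h H∈)) , Encodes.difference (encodes H∈)
    edges≤ : length edges ≤ n * n / 4
    edges≤ = ≤-trans (≤-reflexive (sym (m*n/n≡m (length edges) 4)))
      (/-monoˡ-≤ 4 (≤-trans (≤-reflexive (*-comm (length edges) 4)) length-edges))

  count : numMaximalTriangleFree n ≤ M ^ n * (2 ^ M) ^ M * length sparse * G (n * n / 4)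
  count = ≤-trans (length-fibres code-≟ code codes (maximalTriangleFreeGraphs-unique n)
      (λ {H} H∈ → Encodes.listed (code-encodes H (maximal⁻ H∈))) fibre-bound)
    (≤-reflexive (cong (_* G (n * n / 4))
      (trans (length-cartesianProductWith _,_ containers sparse) (cong (_* length sparse) length-containers))))

  sparse-bound : length sparse * (t ^ n) ^ n ≤ ((1 + t) ^ n) ^ n * t ^ s
  sparse-bound = few-sparse t n s

-- Asymptotics

^-distribʳ-* : ∀ k m n → (m * n) ^ k ≡ m ^ k * n ^ k
^-distribʳ-* zero m n = refl
^-distribʳ-* (suc k) m n = trans (cong (m * n *_) (^-distribʳ-* k m n)) (swap m n (m ^ k) (n ^ k))
  where
  swap : ∀ a b c d → a * b * (c * d) ≡ a * c * (b * d)
  swap = solve-∀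

^-swap : ∀ m a b → (m ^ a) ^ b ≡ (m ^ b) ^ a
^-swap m a b = trans (^-*-assoc m a b) (trans (cong (m ^_) (*-comm a b)) (sym (^-*-assoc m b a)))

n<2^n : ∀ n → n < 2 ^ n
n<2^n zero = s≤s z≤n
n<2^n (suc n) = ≤-trans (+-mono-≤ (m^n>0 2 n) (n<2^n n)) (≤-reflexive (cong (2 ^ n +_) (sym (+-identityʳ (2 ^ n)))))

-- For even `m` the exponent 2 + `m` would do; 3² > 2³ in the odd case costs the extra factor of
-- two.
G² : ∀ m → G m * G m ≤ 2 ^ (3 + m)
G² 0 = m≤m+n 4 4
G² 1 = m≤m+n 9 7
G² (suc (suc m)) = ≤-trans (≤-reflexive (four (G m))) (≤-trans (*-monoʳ-≤ 4 (G² m)) (≤-reflexive (four′ (2 ^ (3 + m)))))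
  where
  four : ∀ g → 2 * g * (2 * g) ≡ 4 * (g * g)
  four = solve-∀
  four′ : ∀ g → 4 * g ≡ 2 * (2 * g)
  four′ = solve-∀

-- Taking eighth powers turns the main exponent N / 8 into an integer; the 12 is four times the 3 of
-- `G²`.
G-quarter : ∀ N → G (N / 4) ^ 8 ≤ 2 ^ (12 + N)
G-quarter N = begin
  G m ^ 8                ≡⟨ eighth (G m) ⟩
  (G m * G m) ^ 4        ≤⟨ ^-monoˡ-≤ 4 (G² m) ⟩
  (2 ^ (3 + m)) ^ 4      ≡⟨ ^-*-assoc 2 (3 + m) 4 ⟩
  2 ^ ((3 + m) * 4)      ≤⟨ ^-monoʳ-≤ 2 (+-monoʳ-≤ 12 (m/n*n≤m N 4)) ⟩
  2 ^ (12 + N)           ∎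
  where
  open ≤-Reasoning
  m = N / 4
  eighth : ∀ g → g ^ 8 ≡ (g * g) ^ 4
  eighth g = trans (sym (^-*-assoc g 2 4)) (cong (λ x → (g * x) ^ 4) (*-identityʳ g))

-- Bernoulli's inequality 1 − j / (t + 1) ≤ (t / (t + 1)) ^ j, cleared of fractions.
bernoulli : ∀ t j c → c + j ≡ suc t → c * suc t ^ j ≤ suc t * t ^ j
bernoulli t zero c eq = ≤-reflexive (cong (_* 1) (trans (sym (+-identityʳ c)) eq))
bernoulli t (suc j) c eq = begin
  c * (suc t * suc t ^ j)           ≡⟨ assoc₁ c (suc t) (suc t ^ j) ⟩
  c * suc t * suc t ^ j             ≤⟨ *-monoˡ-≤ (suc t ^ j) step ⟩
  suc c * t * suc t ^ j             ≡⟨ assoc₂ (suc c) t (suc t ^ j) ⟩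
  t * (suc c * suc t ^ j)           ≤⟨ *-monoʳ-≤ t (bernoulli t j (suc c) (trans (sym (+-suc c j)) eq)) ⟩
  t * (suc t * t ^ j)               ≡⟨ assoc₃ t (suc t) (t ^ j) ⟩
  suc t * (t * t ^ j)               ∎
  where
  open ≤-Reasoning
  assoc₁ : ∀ a b c → a * (b * c) ≡ a * b * c
  assoc₁ = solve-∀
  assoc₂ : ∀ a b c → a * b * c ≡ b * (a * c)
  assoc₂ = solve-∀
  assoc₃ : ∀ a b c → a * (b * c) ≡ b * (a * c)
  assoc₃ = solve-∀
  c≤t : c ≤ t
  c≤t = ≤-trans (m≤m+n c j) (≤-reflexive (suc-injective (trans (sym (+-suc c j)) eq)))
  step : c * suc t ≤ suc c * t
  step = ≤-trans (≤-reflexive (*-suc c t)) (+-monoˡ-≤ (c * t) c≤t)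

-- The aim is an error of order N / `P` in the exponent, N = n². As `T` = 2 `P`, the factor (T / t)
-- ^ N from `few-sparse` is at most 2 ^ (N / P). As t < 2 ^ (a + 1), the factor t ^ s is at most 2 ^
-- ((a + 1) s), and `k` makes s ≤ 4 N / k = N / ((a + 1) P), so this is at most 2 ^ (N / P) as well.
module Precision (a : ℕ) where

  P T t k M : ℕ
  P = 2 ^ a
  T = 2 ^ suc a
  t = pred T
  k = 4 * (suc a * P)
  M = grow (suc (k * (k * k))) 1

  instance
    P≢0 : NonZero P
    P≢0 = m^n≢0 2 a

  P+P≡T : P + P ≡ T
  P+P≡T = cong (P +_) (sym (+-identityʳ P))

  1≤P : 1 ≤ P
  1≤P = m^n>0 2 a

  suc-t : suc t ≡ T
  suc-t = suc-pred T {{m^n≢0 2 (suc a)}}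

  instance
    t≢0 : NonZero t
    t≢0 = >-nonZero (s≤s⁻¹ (≤-trans (+-mono-≤ 1≤P 1≤P) (≤-reflexive (trans P+P≡T (sym suc-t)))))

  2≤k : 2 ≤ k
  2≤k = *-mono-≤ {2} {4} {1} {suc a * P} (s≤s (s≤s z≤n)) (*-mono-≤ {1} {suc a} {1} {P} (s≤s z≤n) 1≤P)

  instance
    k≢0 : NonZero k
    k≢0 = >-nonZero (≤-trans (s≤s z≤n) 2≤k)

  -- Bernoulli gives (t / T) ^ P ≥ 1 - P / T, and the right side is one half.
  T^P≤2t^P : T ^ P ≤ 2 * t ^ P
  T^P≤2t^P = *-cancelˡ-≤ P (begin
    P * T ^ P              ≡⟨ cong (λ T → P * T ^ P) (sym suc-t) ⟩
    P * suc t ^ P          ≤⟨ bernoulli t P P (trans P+P≡T (sym suc-t)) ⟩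
    suc t * t ^ P          ≡⟨ cong (_* t ^ P) (trans suc-t (*-comm 2 P)) ⟩
    P * 2 * t ^ P          ≡⟨ *-assoc P 2 (t ^ P) ⟩
    P * (2 * t ^ P)        ∎)
    where open ≤-Reasoning

  sparse-power : ∀ {x N s} → x * t ^ N ≤ suc t ^ N * t ^ s → s * k ≤ 4 * N → x ^ P ≤ 2 ^ (N + N)
  sparse-power {x} {N} {s} le small = *-cancelʳ-≤ (x ^ P) (2 ^ (N + N)) ((t ^ P) ^ N) {{m^n≢0 (t ^ P) N {{m^n≢0 t P}}}} (begin
    x ^ P * (t ^ P) ^ N                 ≡⟨ cong (x ^ P *_) (^-swap t P N) ⟩
    x ^ P * (t ^ N) ^ P                 ≡⟨ sym (^-distribʳ-* P x (t ^ N)) ⟩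
    (x * t ^ N) ^ P                     ≤⟨ ^-monoˡ-≤ P le ⟩
    (suc t ^ N * t ^ s) ^ P             ≡⟨ cong (λ T → (T ^ N * t ^ s) ^ P) suc-t ⟩
    (T ^ N * t ^ s) ^ P                 ≡⟨ ^-distribʳ-* P (T ^ N) (t ^ s) ⟩
    (T ^ N) ^ P * (t ^ s) ^ P           ≤⟨ *-mono-≤ first second ⟩
    2 ^ N * (t ^ P) ^ N * 2 ^ N         ≡⟨ swap (2 ^ N) ((t ^ P) ^ N) ⟩
    2 ^ N * 2 ^ N * (t ^ P) ^ N         ≡⟨ cong (_* (t ^ P) ^ N) (sym (^-distribˡ-+-* 2 N N)) ⟩
    2 ^ (N + N) * (t ^ P) ^ N           ∎)
    where
    open ≤-Reasoning
    swap : ∀ a b → a * b * a ≡ a * a * b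
    swap = solve-∀
    first : (T ^ N) ^ P ≤ 2 ^ N * (t ^ P) ^ N
    first = begin
      (T ^ N) ^ P            ≡⟨ ^-swap T N P ⟩
      (T ^ P) ^ N            ≤⟨ ^-monoˡ-≤ N T^P≤2t^P ⟩
      (2 * t ^ P) ^ N        ≡⟨ ^-distribʳ-* N 2 (t ^ P) ⟩
      2 ^ N * (t ^ P) ^ N    ∎
    exponent : suc a * s * P ≤ N
    exponent = *-cancelˡ-≤ 4 (≤-trans (≤-reflexive (rearrange (suc a) s P)) small)
      where
      rearrange : ∀ a s P → 4 * (a * s * P) ≡ s * (4 * (a * P))
      rearrange = solve-∀
    second : (t ^ s) ^ P ≤ 2 ^ N
    second = begin
      (t ^ s) ^ P               ≤⟨ ^-monoˡ-≤ P (^-monoˡ-≤ s (≤-trans (n≤1+n t) (≤-reflexive suc-t))) ⟩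
      (T ^ s) ^ P               ≡⟨ cong (_^ P) (^-*-assoc 2 (suc a) s) ⟩
      (2 ^ (suc a * s)) ^ P     ≡⟨ ^-*-assoc 2 (suc a * s) P ⟩
      2 ^ (suc a * s * P)       ≤⟨ ^-monoʳ-≤ 2 exponent ⟩
      2 ^ N                     ∎

  -- Beyond it n² exceeds the terms of the exponent that are linear or constant in n; the leading
  -- `suc` secures 0 < n.
  threshold : ℕ
  threshold = suc ((M + M * M) * (8 * P) + 12 * P)

  -- In the 8P-th power the fibres contribute P n², the choices of S contribute 16 n², and one more
  -- n² absorbs the containers and the additive constant of `G-quarter`; hence 17 + P.
  power-bound : ∀ {n f x s} → threshold ≤ n →
    f ≤ M ^ n * (2 ^ M) ^ M * x * G (n * n / 4) →
    x * (t ^ n) ^ n ≤ (suc t ^ n) ^ n * t ^ s → s * k ≤ 4 * (n * n) →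
    f ^ (8 * P) ≤ 2 ^ ((17 + P) * (n * n))
  power-bound {n} {f} {x} {s} large f≤ x≤ s≤ = begin
    f ^ (8 * P)
      ≤⟨ ^-monoˡ-≤ (8 * P) f≤ ⟩
    (M ^ n * (2 ^ M) ^ M * x * g) ^ (8 * P)
      ≡⟨ trans (^-distribʳ-* (8 * P) (M ^ n * (2 ^ M) ^ M * x) g)
           (cong (_* g ^ (8 * P)) (^-distribʳ-* (8 * P) (M ^ n * (2 ^ M) ^ M) x)) ⟩
    (M ^ n * (2 ^ M) ^ M) ^ (8 * P) * x ^ (8 * P) * g ^ (8 * P)
      ≤⟨ *-mono-≤ (*-mono-≤ containers≤ sparse≤) fibre≤ ⟩
    2 ^ ((M * n + M * M) * (8 * P)) * 2 ^ ((N + N) * 8) * 2 ^ ((12 + N) * P)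
      ≡⟨ trans (cong (_* 2 ^ ((12 + N) * P)) (sym (^-distribˡ-+-* 2 ((M * n + M * M) * (8 * P)) ((N + N) * 8))))
           (sym (^-distribˡ-+-* 2 ((M * n + M * M) * (8 * P) + (N + N) * 8) ((12 + N) * P))) ⟩
    2 ^ ((M * n + M * M) * (8 * P) + (N + N) * 8 + (12 + N) * P)
      ≤⟨ ^-monoʳ-≤ 2 exponent ⟩
    2 ^ ((17 + P) * N) ∎
    where
    open ≤-Reasoning
    N g : ℕ
    N = n * n
    g = G (n * n / 4)
    containers≤ : (M ^ n * (2 ^ M) ^ M) ^ (8 * P) ≤ 2 ^ ((M * n + M * M) * (8 * P))
    containers≤ = begin
      (M ^ n * (2 ^ M) ^ M) ^ (8 * P)        ≤⟨ ^-monoˡ-≤ (8 * P) (*-monoˡ-≤ ((2 ^ M) ^ M) (^-monoˡ-≤ n (<⇒≤ (n<2^n M)))) ⟩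
      ((2 ^ M) ^ n * (2 ^ M) ^ M) ^ (8 * P)  ≡⟨ cong (_^ (8 * P)) (cong₂ _*_ (^-*-assoc 2 M n) (^-*-assoc 2 M M)) ⟩
      (2 ^ (M * n) * 2 ^ (M * M)) ^ (8 * P)  ≡⟨ cong (_^ (8 * P)) (sym (^-distribˡ-+-* 2 (M * n) (M * M))) ⟩
      (2 ^ (M * n + M * M)) ^ (8 * P)        ≡⟨ ^-*-assoc 2 (M * n + M * M) (8 * P) ⟩
      2 ^ ((M * n + M * M) * (8 * P))        ∎
    x≤′ : x * t ^ N ≤ suc t ^ N * t ^ s
    x≤′ = subst₂ _≤_ (cong (x *_) (^-*-assoc t n n)) (cong (_* t ^ s) (^-*-assoc (suc t) n n)) x≤
    sparse≤ : x ^ (8 * P) ≤ 2 ^ ((N + N) * 8)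
    sparse≤ = begin
      x ^ (8 * P)          ≡⟨ trans (cong (x ^_) (*-comm 8 P)) (sym (^-*-assoc x P 8)) ⟩
      (x ^ P) ^ 8          ≤⟨ ^-monoˡ-≤ 8 (sparse-power {x} {N} {s} x≤′ s≤) ⟩
      (2 ^ (N + N)) ^ 8    ≡⟨ ^-*-assoc 2 (N + N) 8 ⟩
      2 ^ ((N + N) * 8)    ∎
    fibre≤ : g ^ (8 * P) ≤ 2 ^ ((12 + N) * P)
    fibre≤ = begin
      g ^ (8 * P)          ≡⟨ sym (^-*-assoc g 8 P) ⟩
      (g ^ 8) ^ P          ≤⟨ ^-monoˡ-≤ P (G-quarter N) ⟩
      (2 ^ (12 + N)) ^ P   ≡⟨ ^-*-assoc 2 (12 + N) P ⟩
      2 ^ ((12 + N) * P)   ∎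
    1≤n : 1 ≤ n
    1≤n = ≤-trans (s≤s z≤n) large
    overhead : (M * n + M * M) * (8 * P) + 12 * P ≤ N
    overhead = begin
      (M * n + M * M) * (8 * P) + 12 * P
        ≤⟨ +-mono-≤ (*-monoˡ-≤ (8 * P) (+-monoʳ-≤ (M * n) (m≤m*n (M * M) n {{>-nonZero 1≤n}}))) (m≤m*n (12 * P) n {{>-nonZero 1≤n}}) ⟩
      (M * n + M * M * n) * (8 * P) + 12 * P * n
        ≡⟨ factor M n P ⟩
      ((M + M * M) * (8 * P) + 12 * P) * n
        ≤⟨ *-monoˡ-≤ n (≤-trans (n≤1+n _) large) ⟩
      N ∎
      where
      factor : ∀ M n P → (M * n + M * M * n) * (8 * P) + 12 * P * n ≡ ((M + M * M) * (8 * P) + 12 * P) * n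
      factor = solve-∀
    exponent : (M * n + M * M) * (8 * P) + (N + N) * 8 + (12 + N) * P ≤ (17 + P) * N
    exponent = begin
      (M * n + M * M) * (8 * P) + (N + N) * 8 + (12 + N) * P
        ≡⟨ collect ((M * n + M * M) * (8 * P)) N P ⟩
      (M * n + M * M) * (8 * P) + 12 * P + (16 + P) * N
        ≤⟨ +-monoˡ-≤ ((16 + P) * N) overhead ⟩
      (17 + P) * N ∎
      where
      collect : ∀ c N P → c + (N + N) * 8 + (12 + N) * P ≡ c + 12 * P + (16 + P) * N
      collect = solve-∀

-- The error term and rational exponents

open import Data.Integer.Base as ℤ using (+_; -[1+_])
import Data.Integer.Properties as ℤ

-- Taking roots, the number of graphs is at most 2 to the power n² / 8 + 17 n² / (8 * 2 ^ a).
Good : ℕ → ℕ → Set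
Good n a = numMaximalTriangleFree n ^ (8 * 2 ^ a) ≤ 2 ^ ((17 + 2 ^ a) * (n * n))

good? : ∀ n a → Dec (Good n a)
good? n a = numMaximalTriangleFree n ^ (8 * 2 ^ a) ≤? 2 ^ ((17 + 2 ^ a) * (n * n))

good-beyond : ∀ a n → Precision.threshold a ≤ n → Good n a
good-beyond a n large = power-bound {s = Count.s n 0<n k 2≤k t} large (Count.count n 0<n k 2≤k t) (Count.sparse-bound n 0<n k 2≤k t) (m/n*n≤m (4 * (n * n)) k)
  where
  open Precision a
  0<n : 0 < n
  0<n = ≤-trans (s≤s z≤n) large

-- At `a` = 0 the exponent 18 n² / 8 already exceeds the n² of all 0/1 matrices, so every n has some
-- valid precision.
good-zero : ∀ n → Good n 0
good-zero n = begin
  numMaximalTriangleFree n ^ 8  ≤⟨ ^-monoˡ-≤ 8 (length-filter isMaximalTriangleFreeGraph? (allMatrices n)) ⟩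
  length (allMatrices n) ^ 8    ≡⟨ cong (_^ 8) (trans (length-allVecs (allSubsets n) n)
                                     (cong (_^ n) (length-allVecs (true ∷ false ∷ []) n))) ⟩
  ((2 ^ n) ^ n) ^ 8             ≡⟨ trans (cong (_^ 8) (^-*-assoc 2 n n)) (^-*-assoc 2 (n * n) 8) ⟩
  2 ^ (n * n * 8)               ≤⟨ ^-monoʳ-≤ 2 (≤-trans (≤-reflexive (*-comm (n * n) 8)) (*-monoˡ-≤ (n * n) (m≤m+n 8 10))) ⟩
  2 ^ (18 * (n * n))            ∎
  where open ≤-Reasoning

module _ {P : ℕ → Set} (P? : ∀ a → Dec (P a)) where

  largest-step : ∀ {m} → Dec (P (suc m)) → ℕ → ℕ
  largest-step {m} (yes _) _ = suc m
  largest-step (no _) a = a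

  largest : ℕ → ℕ
  largest zero = 0
  largest (suc m) = largest-step (P? (suc m)) (largest m)

  largest-satisfies : P 0 → ∀ m → P (largest m)
  largest-satisfies p zero = p
  largest-satisfies p (suc m) = step (P? (suc m))
    where
    step : (d : Dec (P (suc m))) → P (largest-step d (largest m))
    step (yes q) = q
    step (no _) = largest-satisfies p m

  largest-maximal : ∀ {a} → P a → ∀ m → a ≤ m → a ≤ largest m
  largest-maximal p zero a≤0 = a≤0
  largest-maximal {a} p (suc m) a≤m = step (P? (suc m)) (m≤n⇒m<n∨m≡n a≤m)
    where
    step : (d : Dec (P (suc m))) → a < suc m ⊎ a ≡ suc m → a ≤ largest-step d (largest m)
    step (yes _) _ = a≤m
    step (no _) (inj₁ (s≤s a≤)) = largest-maximal p m a≤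
    step (no ¬q) (inj₂ refl) = contradiction p ¬q

-- The bound Good n a is decidable, so the error term is read off the number of graphs itself, and the
-- (tower-type) thresholds enter only the proof that it is o(n²).
precision : ℕ → ℕ
precision n = largest (good? n) n

precision-good : ∀ n → Good n (precision n)
precision-good n = largest-satisfies (good? n) (good-zero n) n

precision-≥ : ∀ a n → Precision.threshold a ≤ n → a ≤ n → a ≤ precision n
precision-≥ a n large = largest-maximal (good? n) (good-beyond a n large) n

-- The relation `≤2^` inspects the reduced fraction, while the bound is proved for an unreduced one.
-- Raising each inequality to the denominator of the other makes the exponents equal, and strict
-- monotonicity of powers allows taking the root again.
≤2^-intro : ∀ {x p d-1} q → ℚ.toℚᵘ q ≃ mkℚᵘ (+ p) d-1 → x ^ suc d-1 ≤ 2 ^ p → x ≤2^ q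
≤2^-intro {x} {p} {d-1} (mkℚ (+ p′) d′-1 _) (*≡* eq) le = ≮⇒≥ λ lt → <⇒≱ (begin-strict
    2 ^ (p * suc d′-1)        ≡⟨ cong (2 ^_) (sym p′d≡pd′) ⟩
    2 ^ (p′ * suc d-1)        ≡⟨ sym (^-*-assoc 2 p′ (suc d-1)) ⟩
    (2 ^ p′) ^ suc d-1        <⟨ ^-monoˡ-< (suc d-1) lt ⟩
    (x ^ suc d′-1) ^ suc d-1  ≡⟨ ^-swap x (suc d′-1) (suc d-1) ⟩
    (x ^ suc d-1) ^ suc d′-1  ∎)
    (≤-trans (^-monoˡ-≤ (suc d′-1) le) (≤-reflexive (^-*-assoc 2 p (suc d′-1))))
  where
  open ≤-Reasoning
  p′d≡pd′ : p′ * suc d-1 ≡ p * suc d′-1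
  p′d≡pd′ = ℤ.+-injective (trans (ℤ.pos-* p′ (suc d-1)) (trans eq (sym (ℤ.pos-* p (suc d′-1)))))
≤2^-intro {p = p} (mkℚ -[1+ _ ] d′-1 _) (*≡* eq) le = case trans eq (sym (ℤ.pos-* p (suc d′-1))) of λ ()

denominator : ℕ → ℕ
denominator n = 8 * 2 ^ precision n

denominator-1 : ℕ → ℕ
denominator-1 n = pred (denominator n)

suc-denominator-1 : ∀ n → suc (denominator-1 n) ≡ denominator n
suc-denominator-1 n = suc-pred (denominator n) {{m*n≢0 8 (2 ^ precision n) {{_}} {{m^n≢0 2 (precision n)}}}}

errorᵘ : ℕ → ℚᵘ
errorᵘ n = mkℚᵘ (+ (17 * n ^ 2)) (denominator-1 n)

error : ℕ → ℚ
error n = ℚ.fromℚᵘ (errorᵘ n)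

n^2≡n*n : ∀ n → n ^ 2 ≡ n * n
n^2≡n*n n = cong (n *_) (*-identityʳ n)

error-bound : ∀ n → numMaximalTriangleFree n ≤2^ ((+ (n ^ 2)) ℚ./ 8 ℚ.+ error n)
-- Unnormalised rationals store the denominator minus one: `denominator-1 n + 7 * D` stands for the
-- common denominator 8 * `D`.
error-bound n = ≤2^-intro {p = n ^ 2 * D + 17 * n ^ 2 * 8} {d-1 = denominator-1 n + 7 * D} _ sum≃ (begin
  f ^ (8 * D)                           ≡⟨ trans (cong (λ D → f ^ (8 * D)) D≡) (trans (cong (f ^_) (*-comm 8 (8 * P))) (sym (^-*-assoc f (8 * P) 8))) ⟩
  (f ^ (8 * P)) ^ 8                     ≤⟨ ^-monoˡ-≤ 8 (precision-good n) ⟩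
  (2 ^ ((17 + P) * (n * n))) ^ 8        ≡⟨ ^-*-assoc 2 ((17 + P) * (n * n)) 8 ⟩
  2 ^ ((17 + P) * (n * n) * 8)          ≡⟨ cong (2 ^_) (trans (expand P (n * n))
                                             (cong₂ (λ D x → x * D + 17 * x * 8) (sym D≡) (sym (n^2≡n*n n)))) ⟩
  2 ^ (n ^ 2 * D + 17 * n ^ 2 * 8)      ∎)
  where
  open ≤-Reasoning
  f P D : ℕ
  f = numMaximalTriangleFree n
  P = 2 ^ precision n
  D = suc (denominator-1 n)
  D≡ : D ≡ 8 * P
  D≡ = suc-denominator-1 n
  expand : ∀ P x → (17 + P) * x * 8 ≡ x * (8 * P) + 17 * x * 8
  expand = solve-∀
  numerator : + (n ^ 2) ℤ.* + D ℤ.+ + (17 * n ^ 2) ℤ.* + 8 ≡ + (n ^ 2 * D + 17 * n ^ 2 * 8)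
  numerator = sym (trans (ℤ.pos-+ (n ^ 2 * D) (17 * n ^ 2 * 8)) (cong₂ ℤ._+_ (ℤ.pos-* (n ^ 2) D) (ℤ.pos-* (17 * n ^ 2) 8)))
  sum≃ : ℚ.toℚᵘ ((+ (n ^ 2)) ℚ./ 8 ℚ.+ error n) ≃ mkℚᵘ (+ (n ^ 2 * D + 17 * n ^ 2 * 8)) (denominator-1 n + 7 * D)
  sum≃ = ℚᵘ.≃-trans (ℚ.toℚᵘ-homo-+ ((+ (n ^ 2)) ℚ./ 8) (error n))
    (ℚᵘ.≃-trans (ℚᵘ.+-cong (ℚ.toℚᵘ-fromℚᵘ (mkℚᵘ (+ (n ^ 2)) 7)) (ℚ.toℚᵘ-fromℚᵘ (errorᵘ n)))
      (*≡* (cong (ℤ._* + (8 * D)) numerator)))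

error-little-o : IsLittleO-n² error
error-little-o (mkℚ (+ zero) q-1 _) (ℚ.*<* (ℤ.+<+ ()))
error-little-o (mkℚ (-[1+ _ ]) q-1 _) (ℚ.*<* ())
error-little-o ε@(mkℚ (+ suc p-1) q-1 _) _ = N , small
  where
  a N : ℕ
  -- With q = `suc q-1` this is q + 2, so 8 * 2 ^ a = 32 * 2 ^ q exceeds 17 q, while ε is at least 1
  -- / q.
  a = suc (suc (suc q-1))
  -- The maximum with `a` is taken because `precision n` searches only up to n.
  N = Precision.threshold a ⊔ a
  17q<D : ∀ n → a ≤ precision n → 17 * suc q-1 < denominator n
  17q<D n a≤ = begin-strict
    17 * suc q-1            <⟨ *-monoˡ-< (suc q-1) (m≤m+n 18 14) ⟩
    32 * suc q-1            ≤⟨ *-monoʳ-≤ 32 (<⇒≤ (n<2^n (suc q-1))) ⟩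
    32 * 2 ^ suc q-1        ≡⟨ thirtytwo (2 ^ suc q-1) ⟩
    8 * 2 ^ a               ≤⟨ *-monoʳ-≤ 8 (^-monoʳ-≤ 2 a≤) ⟩
    denominator n           ∎
    where
    open ≤-Reasoning
    thirtytwo : ∀ x → 32 * x ≡ 8 * (2 * (2 * x))
    thirtytwo = solve-∀
  small : ∀ n .{{_ : NonZero n}} → N ≤ n → ℚ.∣ error n ℚ.* (ℚ._/_ (+ 1) (n ^ 2) {{m^n≢0 n 2}}) ∣ ℚ.< ε
  small zero N≤ = contradiction (≤-trans (m≤n⊔m (Precision.threshold a) a) N≤) λ ()
  small n@(suc m) N≤ = ℚ.toℚᵘ-cancel-< (ℚᵘ.<-respˡ-≃ (ℚᵘ.≃-sym abs≃) less)
    where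
    x D : ℕ
    x = n * (n * 1)
    D = suc (denominator-1 n)
    inverse : ℚᵘ
    inverse = mkℚᵘ (+ 1) (pred x)
    abs≃ : ℚ.toℚᵘ ℚ.∣ error n ℚ.* ℚ.fromℚᵘ inverse ∣ ≃ ℚᵘ.∣ errorᵘ n ℚᵘ.* inverse ∣
    abs≃ = ℚᵘ.≃-trans (ℚ.toℚᵘ-homo-∣-∣ (error n ℚ.* ℚ.fromℚᵘ inverse))
      (ℚᵘ.∣-∣-cong (ℚᵘ.≃-trans (ℚ.toℚᵘ-homo-* (error n) (ℚ.fromℚᵘ inverse))
        (ℚᵘ.*-cong (ℚ.toℚᵘ-fromℚᵘ (errorᵘ n)) (ℚ.toℚᵘ-fromℚᵘ inverse))))
    abs-numerator : ℤ.∣ + (17 * x) ℤ.* + 1 ∣ ≡ 17 * x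
    abs-numerator = cong ℤ.∣_∣ (ℤ.*-identityʳ (+ (17 * x)))
    product : 17 * x * suc q-1 < suc p-1 * (D * x)
    product = begin-strict
      17 * x * suc q-1       ≡⟨ rearrange x (suc q-1) ⟩
      17 * suc q-1 * x       <⟨ *-monoˡ-< x (17q<D n (precision-≥ a n (≤-trans (m≤m⊔n (Precision.threshold a) a) N≤)
                                  (≤-trans (m≤n⊔m (Precision.threshold a) a) N≤))) ⟩
      denominator n * x      ≡⟨ cong (_* x) (sym (suc-denominator-1 n)) ⟩
      D * x                  ≤⟨ m≤m+n (D * x) (p-1 * (D * x)) ⟩
      suc p-1 * (D * x)      ∎
      where
      open ≤-Reasoning
      rearrange : ∀ x q → 17 * x * q ≡ 17 * q * x
      rearrange = solve-∀
    less : ℚᵘ.∣ errorᵘ n ℚᵘ.* inverse ∣ ℚᵘ.< mkℚᵘ (+ suc p-1) q-1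
    less = ℚᵘ.*<* (subst₂ ℤ._<_
      (trans (ℤ.pos-* (17 * x) (suc q-1)) (cong (λ m → + m ℤ.* + suc q-1) (sym abs-numerator)))
      (ℤ.pos-* (suc p-1) (D * x)) (ℤ.+<+ product))

theorem1 : ∃[ g ] (IsLittleO-n² g × (∀ (n : ℕ) → numMaximalTriangleFree n ≤2^ ((+ (n ^ 2)) ℚ./ 8 ℚ.+ g n)))
theorem1 = error , error-little-o , error-bound
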